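{- For every $\#1$-attribute SR instance $I$, the number of stable assignments of $I$ is either $1$ or $2$. Thus, $\#1$-attribute SR can be solved exactly in polynomial time.
   Context: A stable roommate instance consists of $2n$ people ($n\ge 1$), each having a strict total preference order on the other $2n-1$ people. An assignment (matching) is a partition of the people into $n$ pairs. It is stable if there is no blocking pair, i.e. no two people, not paired together, each of whom prefers the other to his/her current partner. In the $1$-attribute model, each person $X$ has a preference value $\hat X\in\mathbb{R}$ and a position value $\bar X\in\mathbb{R}$, and $X$ prefers $Y$ to $Z$ (with $X,Y,Z$ distinct) if and only if $\hat X\,\bar Y>\hat X\,\bar Z$. A valid instance has $\hat X\,\bar Y\neq\hat X\,\bar Z$ whenever $Y\ne Z$ are people other than $X$. The problem $\#1$-attribute SR: the instance is a (valid) stable roommate instance with $2n$ people in the $1$-attribute model; the output is the number of stable assignments. -}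

module Defs where

open import Data.Fin using (Fin; zero; toℕ)
open import Data.Fin.Properties using (all?; _≟_)
open import Data.List using (List; []; _∷_; map; allFin; filter; length; cartesianProductWith)
open import Data.List.Membership.Propositional using (_∈_)
open import Data.List.Relation.Unary.Unique.Propositional using (Unique)
open import Data.Nat using (ℕ; zero; suc; _⊔_) renaming (_+_ to _+ᴺ_; _*_ to _*ᴺ_; _≤_ to _≤ᴺ_; _^_ to _^ᴺ_)
import Data.Nat.Properties as ℕₚ
open import Data.Product using (Σ; ∃-syntax; _×_; _,_)
open import Data.Rational using (ℚ; 0ℚ; 1ℚ; ½; _+_; _*_; _-_; -_; ∣_∣; _≤_; _<_; 1/_; Positive; NonZero; positive)
import Data.Rational.Properties as ℚₚ
open import Data.Vec using (Vec; []; _∷_; lookup; replicate; _[_]≔_)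
open import Function using (_⇔_)
open import Relation.Binary.PropositionalEquality using (_≡_; _≢_; sym; trans; cong; cong₂)
open import Relation.Nullary using (¬_; Dec; ¬?; _×-dec_)

-- Real numbers: Cauchy sequences of rationals.  Only multiplication and
-- the strict order occur below, and both respect equality of limits, so
-- no quotient is taken.

Cauchy : (ℕ → ℚ) → Set
Cauchy s = ∀ ε → 0ℚ < ε → ∃[ N ] ∀ m n → N ≤ᴺ m → N ≤ᴺ n → ∣ s m - s n ∣ < ε

record ℝ : Set where
  constructor mkℝ
  field
    seq    : ℕ → ℚ
    cauchy : Cauchy seq

open ℝ public

_<ᴿ_ : ℝ → ℝ → Set
x <ᴿ y = ∃[ ε ] 0ℚ < ε × ∃[ N ] ∀ n → N ≤ᴺ n → seq x n + ε < seq y n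

module CauchyLemmas where
  split : ∀ a b → (a - b) + b ≡ a
  split a b = trans (ℚₚ.+-assoc a (- b) b)
                (trans (cong (a +_) (ℚₚ.+-inverseˡ b)) (ℚₚ.+-identityʳ a))

  insert : ∀ a b c → a - c ≡ (a - b) + (b - c)
  insert a b c = sym (trans (sym (ℚₚ.+-assoc (a - b) b (- c))) (cong (_- c) (split a b)))

  telescope : ∀ a b c d → a * c - b * d ≡ a * (c - d) + (a - b) * d
  telescope a b c d = trans (insert (a * c) (a * d) (b * d)) (cong₂ _+_
    (sym (trans (ℚₚ.*-distribˡ-+ a c (- d)) (cong (a * c +_) (sym (ℚₚ.neg-distribʳ-* a d)))))
    (sym (trans (ℚₚ.*-distribʳ-+ d a (- b)) (cong (a * d +_) (sym (ℚₚ.neg-distribˡ-* b d))))))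

  halves : ∀ ε → ½ * ε + ½ * ε ≡ ε
  halves ε = trans (sym (ℚₚ.*-distribʳ-+ ε ½ ½)) (ℚₚ.*-identityˡ ε)

  eventuallyBounded : ∀ s → Cauchy s →
                      ∃[ B ] Positive B × ∃[ N ] ∀ n → N ≤ᴺ n → ∣ s n ∣ ≤ B
  eventuallyBounded s c with c 1ℚ (ℚₚ.positive⁻¹ 1ℚ)
  ... | N , close = 1ℚ + ∣ s N ∣ , ℚₚ.pos+nonNeg⇒pos 1ℚ ∣ s N ∣ {{ℚₚ.∣-∣-nonNeg (s N)}} , N , bound
    where
    open ℚₚ.≤-Reasoning
    bound : ∀ n → N ≤ᴺ n → ∣ s n ∣ ≤ 1ℚ + ∣ s N ∣
    bound n N≤n = begin
      ∣ s n ∣                    ≡⟨ cong ∣_∣ (split (s n) (s N)) ⟨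
      ∣ (s n - s N) + s N ∣      ≤⟨ ℚₚ.∣p+q∣≤∣p∣+∣q∣ (s n - s N) (s N) ⟩
      ∣ s n - s N ∣ + ∣ s N ∣    ≤⟨ ℚₚ.+-monoˡ-≤ ∣ s N ∣ (ℚₚ.<⇒≤ (close n N N≤n ℕₚ.≤-refl)) ⟩
      1ℚ + ∣ s N ∣               ∎

  shrink : ∀ B → Positive B → ∀ ε → 0ℚ < ε → ∃[ δ ] 0ℚ < δ × B * δ ≡ ½ * ε
  shrink B B>0 ε ε>0 = 1/ B * (½ * ε) , ℚₚ.positive⁻¹ _ {{δ>0}} , eq
    where
    instance
      _ : Positive B
      _ = B>0
      B≢0 : NonZero B
      B≢0 = ℚₚ.pos⇒nonZero B
    δ>0 : Positive (1/ B * (½ * ε))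
    δ>0 = ℚₚ.pos*pos⇒pos (1/ B) {{ℚₚ.1/pos⇒pos B}} (½ * ε)
            {{ℚₚ.pos*pos⇒pos ½ ε {{positive ε>0}}}}
    eq : B * (1/ B * (½ * ε)) ≡ ½ * ε
    eq = trans (sym (ℚₚ.*-assoc B (1/ B) (½ * ε)))
           (trans (cong (_* (½ * ε)) (ℚₚ.*-inverseʳ B)) (ℚₚ.*-identityˡ (½ * ε)))

  *-cauchy : ∀ s t → Cauchy s → Cauchy t → Cauchy (λ n → s n * t n)
  *-cauchy s t cs ct ε ε>0
    with eventuallyBounded s cs | eventuallyBounded t ct
  ... | B , B>0 , N₁ , s≤B | C , C>0 , N₂ , t≤C
    with shrink B B>0 ε ε>0 | shrink C C>0 ε ε>0
  ... | δ , δ>0 , Bδ | η , η>0 , Cη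
    with ct δ δ>0 | cs η η>0
  ... | N₃ , t-close | N₄ , s-close = (N₁ ⊔ N₂) ⊔ (N₃ ⊔ N₄) , close
    where
    open ℚₚ.≤-Reasoning
    close : ∀ m n → (N₁ ⊔ N₂) ⊔ (N₃ ⊔ N₄) ≤ᴺ m → (N₁ ⊔ N₂) ⊔ (N₃ ⊔ N₄) ≤ᴺ n →
            ∣ s m * t m - s n * t n ∣ < ε
    close m n ≤m ≤n = begin-strict
      ∣ s m * t m - s n * t n ∣
        ≡⟨ cong ∣_∣ (telescope (s m) (s n) (t m) (t n)) ⟩
      ∣ s m * (t m - t n) + (s m - s n) * t n ∣
        ≤⟨ ℚₚ.∣p+q∣≤∣p∣+∣q∣ (s m * (t m - t n)) ((s m - s n) * t n) ⟩
      ∣ s m * (t m - t n) ∣ + ∣ (s m - s n) * t n ∣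
        ≡⟨ cong₂ _+_ (ℚₚ.∣p*q∣≡∣p∣*∣q∣ (s m) (t m - t n))
                     (trans (ℚₚ.∣p*q∣≡∣p∣*∣q∣ (s m - s n) (t n))
                            (ℚₚ.*-comm ∣ s m - s n ∣ ∣ t n ∣)) ⟩
      ∣ s m ∣ * ∣ t m - t n ∣ + ∣ t n ∣ * ∣ s m - s n ∣
        ≤⟨ ℚₚ.+-mono-≤
             (ℚₚ.*-monoʳ-≤-nonNeg ∣ t m - t n ∣ {{ℚₚ.∣-∣-nonNeg (t m - t n)}} (s≤B m N₁≤m))
             (ℚₚ.*-monoʳ-≤-nonNeg ∣ s m - s n ∣ {{ℚₚ.∣-∣-nonNeg (s m - s n)}} (t≤C n N₂≤n)) ⟩
      B * ∣ t m - t n ∣ + C * ∣ s m - s n ∣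
        <⟨ ℚₚ.+-mono-<
             (ℚₚ.*-monoʳ-<-pos B {{B>0}} (t-close m n N₃≤m N₃≤n))
             (ℚₚ.*-monoʳ-<-pos C {{C>0}} (s-close m n N₄≤m N₄≤n)) ⟩
      B * δ + C * η
        ≡⟨ cong₂ _+_ Bδ Cη ⟩
      ½ * ε + ½ * ε
        ≡⟨ halves ε ⟩
      ε ∎
      where
      N₁≤m = ℕₚ.≤-trans (ℕₚ.m≤m⊔n N₁ N₂) (ℕₚ.≤-trans (ℕₚ.m≤m⊔n (N₁ ⊔ N₂) (N₃ ⊔ N₄)) ≤m)
      N₂≤n = ℕₚ.≤-trans (ℕₚ.m≤n⊔m N₁ N₂) (ℕₚ.≤-trans (ℕₚ.m≤m⊔n (N₁ ⊔ N₂) (N₃ ⊔ N₄)) ≤n)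
      N₃≤m = ℕₚ.≤-trans (ℕₚ.m≤m⊔n N₃ N₄) (ℕₚ.≤-trans (ℕₚ.m≤n⊔m (N₁ ⊔ N₂) (N₃ ⊔ N₄)) ≤m)
      N₃≤n = ℕₚ.≤-trans (ℕₚ.m≤m⊔n N₃ N₄) (ℕₚ.≤-trans (ℕₚ.m≤n⊔m (N₁ ⊔ N₂) (N₃ ⊔ N₄)) ≤n)
      N₄≤m = ℕₚ.≤-trans (ℕₚ.m≤n⊔m N₃ N₄) (ℕₚ.≤-trans (ℕₚ.m≤n⊔m (N₁ ⊔ N₂) (N₃ ⊔ N₄)) ≤m)
      N₄≤n = ℕₚ.≤-trans (ℕₚ.m≤n⊔m N₃ N₄) (ℕₚ.≤-trans (ℕₚ.m≤n⊔m (N₁ ⊔ N₂) (N₃ ⊔ N₄)) ≤n)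

open CauchyLemmas using (*-cauchy)

infixl 7 _*ᴿ_
infix 4 _<ᴿ_

_*ᴿ_ : ℝ → ℝ → ℝ
x *ᴿ y = mkℝ (λ n → seq x n * seq y n) (*-cauchy (seq x) (seq y) (cauchy x) (cauchy y))

Person : ℕ → Set
Person n = Fin (2 *ᴺ n)

-- A strict total order on the people other than x is given by listing
-- them, most preferred first.
record Roommates (n : ℕ) : Set where
  field
    prefs    : Person n → List (Person n)
    unique   : ∀ x → Unique (prefs x)
    complete : ∀ x y → y ∈ prefs x ⇔ y ≢ x

open Roommates public

module _ {n : ℕ} where
  open import Data.List.Relation.Binary.Sublist.DecPropositional (_≟_ {2 *ᴺ n})
    using (_⊆_; _⊆?_)

  -- "x prefers y to z": y is listed before z, i.e. the two-element list
  -- y , z is an order-preserving sublist of x's list.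
  Prefers : Roommates n → Person n → Person n → Person n → Set
  Prefers I x y z = y ∷ z ∷ [] ⊆ prefs I x

  prefers? : ∀ I x y z → Dec (Prefers I x y z)
  prefers? I x y z = y ∷ z ∷ [] ⊆? prefs I x

-- A partition of the people into pairs, as the table of partners.
IsAssignment : ∀ {m} → Vec (Fin m) m → Set
IsAssignment μ = ∀ x → lookup μ x ≢ x × lookup μ (lookup μ x) ≡ x

Blocks : ∀ {n} → Roommates n → Vec (Person n) (2 *ᴺ n) → Person n → Person n → Set
Blocks I μ x y = x ≢ y × lookup μ x ≢ y
               × Prefers I x y (lookup μ x) × Prefers I y x (lookup μ y)

IsStableAssignment : ∀ {n} → Roommates n → Vec (Person n) (2 *ᴺ n) → Set
IsStableAssignment I μ = IsAssignment μ × (∀ x y → ¬ Blocks I μ x y)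

isStableAssignment? : ∀ {n} (I : Roommates n) μ → Dec (IsStableAssignment I μ)
isStableAssignment? I μ =
  all? (λ x → ¬? (lookup μ x ≟ x) ×-dec (lookup μ (lookup μ x) ≟ x))
  ×-dec
  all? (λ x → all? λ y → ¬? (
    ¬? (x ≟ y) ×-dec ¬? (lookup μ x ≟ y)
    ×-dec prefers? I x y (lookup μ x) ×-dec prefers? I y x (lookup μ y)))

-- Every vector over Fin m of length k, each exactly once.
allVectors : ∀ m k → List (Vec (Fin m) k)
allVectors m zero    = [] ∷ []
allVectors m (suc k) = cartesianProductWith _∷_ (allFin m) (allVectors m k)

countStable : ∀ {n} → Roommates n → ℕ
countStable {n} I = length (filter (isStableAssignment? I) (allVectors (2 *ᴺ n) (2 *ᴺ n)))

-- Validity (preferenceX · positionY ≠ preferenceX · positionZ) needs no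
-- separate field: y and z are strictly comparable in x's list, so by
-- `induces` one of the two products is strictly smaller than the other.
record OneAttributeModel {n : ℕ} (I : Roommates n) : Set where
  field
    preference : Person n → ℝ
    position   : Person n → ℝ
    induces    : ∀ x y z → x ≢ y → x ≢ z → y ≢ z →
                 Prefers I x y z ⇔ preference x *ᴿ position z <ᴿ preference x *ᴿ position y

record OneAttributeSR : Set where
  field
    n         : ℕ
    n≥1       : 1 ≤ᴺ n
    roommates : Roommates n
    model     : OneAttributeModel roommates

numberOfStableAssignments : OneAttributeSR → ℕ
numberOfStableAssignments I = countStable (OneAttributeSR.roommates I)

-- Polynomial time, via Jones's language WHILE over binary trees.  Every
-- expression node, assignment and test costs one step; since trees can be
-- shared, a step is a constant number of pointer operations, and the
-- polynomial-time problems are those of Turing machines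
-- (N. D. Jones, Computability and Complexity from a Programming
-- Perspective, MIT Press 1997).

infixr 5 _∙_

data Tree : Set where
  nil : Tree
  _∙_ : Tree → Tree → Tree

size : Tree → ℕ
size nil     = 1
size (s ∙ t) = suc (size s +ᴺ size t)

data Expr (k : ℕ) : Set where
  var   : Fin k → Expr k
  nil   : Expr k
  cons  : Expr k → Expr k → Expr k
  hd tl : Expr k → Expr k

Store : ℕ → Set
Store k = Vec Tree k

head tail : Tree → Tree
head nil     = nil
head (s ∙ t) = s
tail nil     = nil
tail (s ∙ t) = t

eval : ∀ {k} → Expr k → Store k → Tree
eval (var i)    σ = lookup σ i
eval nil        σ = nil
eval (cons e f) σ = eval e σ ∙ eval f σ
eval (hd e)     σ = head (eval e σ)
eval (tl e)     σ = tail (eval e σ)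

cost : ∀ {k} → Expr k → ℕ
cost (var i)    = 1
cost nil        = 1
cost (cons e f) = suc (cost e +ᴺ cost f)
cost (hd e)     = suc (cost e)
cost (tl e)     = suc (cost e)

infix  7 _≔_
infixr 6 _⨾_

data Command (k : ℕ) : Set where
  _≔_           : Fin k → Expr k → Command k
  _⨾_           : Command k → Command k → Command k
  if_then_else_ : Expr k → Command k → Command k → Command k
  while_run_    : Expr k → Command k → Command k

-- ⟨ p , σ ⟩⇓⟨ τ , t ⟩: from store σ, p halts in store τ after t steps.
-- In tests, nil is false and every other tree is true.
infix 4 ⟨_,_⟩⇓⟨_,_⟩

data ⟨_,_⟩⇓⟨_,_⟩ {k : ℕ} : Command k → Store k → Store k → ℕ → Set where
  assign  : ∀ {i e σ} →
            ⟨ i ≔ e , σ ⟩⇓⟨ σ [ i ]≔ eval e σ , suc (cost e) ⟩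
  compose : ∀ {p q σ τ υ s t} →
            ⟨ p , σ ⟩⇓⟨ τ , s ⟩ → ⟨ q , τ ⟩⇓⟨ υ , t ⟩ →
            ⟨ p ⨾ q , σ ⟩⇓⟨ υ , s +ᴺ t ⟩
  if-true : ∀ {e p q σ τ t} → eval e σ ≢ nil →
            ⟨ p , σ ⟩⇓⟨ τ , t ⟩ →
            ⟨ if e then p else q , σ ⟩⇓⟨ τ , suc (cost e) +ᴺ t ⟩
  if-false : ∀ {e p q σ τ t} → eval e σ ≡ nil →
            ⟨ q , σ ⟩⇓⟨ τ , t ⟩ →
            ⟨ if e then p else q , σ ⟩⇓⟨ τ , suc (cost e) +ᴺ t ⟩
  while-true : ∀ {e p σ τ υ s t} → eval e σ ≢ nil →
            ⟨ p , σ ⟩⇓⟨ τ , s ⟩ → ⟨ while e run p , τ ⟩⇓⟨ υ , t ⟩ →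
            ⟨ while e run p , σ ⟩⇓⟨ υ , suc (cost e) +ᴺ (s +ᴺ t) ⟩
  while-false : ∀ {e p σ} → eval e σ ≡ nil →
            ⟨ while e run p , σ ⟩⇓⟨ σ , suc (cost e) ⟩

encodeℕ : ℕ → Tree
encodeℕ zero    = nil
encodeℕ (suc n) = nil ∙ encodeℕ n

encodeList : List Tree → Tree
encodeList []       = nil
encodeList (t ∷ ts) = t ∙ encodeList ts

-- The input is the table of preference lists.  Unary names cost only a
-- polynomial factor, as the input already has 2n(2n - 1) entries.
encodeRoommates : ∀ {n} → Roommates n → Tree
encodeRoommates {n} I =
  encodeList (map (λ x → encodeList (map (λ y → encodeℕ (toℕ y)) (prefs I x)))
                  (allFin (2 *ᴺ n)))

encodeInstance : OneAttributeSR → Tree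
encodeInstance I = encodeRoommates (OneAttributeSR.roommates I)

-- A single program, with variable 0 for input and output and all other
-- variables initially nil.  Sizes are at least 1, so c · size ^ d ranges
-- over bounds equivalent to arbitrary polynomials.
PolynomialTime : {A : Set} → (A → Tree) → (A → ℕ) → Set
PolynomialTime {A} encode f =
  ∃[ k ] Σ (Command (suc k)) λ p → ∃[ c ] ∃[ d ] ∀ (a : A) →
    ∃[ τ ] ∃[ t ]
      ⟨ p , encode a ∷ replicate k nil ⟩⇓⟨ τ , t ⟩
      × lookup τ zero ≡ encodeℕ (f a)
      × t ≤ᴺ c *ᴺ size (encode a) ^ᴺ d

{-# OPTIONS --safe #-}
-- Order the people by position.  Everybody wants partners as high as possible (is "up") or as low as possible (is
-- "down").  Let P be the number of ups, cut the line below the P-th person from the top, and read the top part X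
-- downwards and the bottom part Y upwards; then X contains as many downs as Y contains ups.  Looking at the outermost
-- people of X and Y, every stable assignment contains a certain pair, whose removal keeps the cut in place:
--   two ups at the outer end of X, or two downs at the outer end of Y, choose each other;
--   a down at the outer end of X and an up at the outer end of Y choose each other;
--   if the outermost person of X is an up t followed by a down s, and Y starts with an up b, then s and b are paired,
--   as t would be the only other choice of b; if Y starts with a down followed by an up c, then s and c are paired;
-- and symmetrically.  The last two rules need somebody in X behind s and, if c is present, somebody in Y behind c.
-- Without them, at most one more pair is forced.  Then either only two people are left, or an up may be paired with
-- either of the first two people t and s; the others all want the same direction, so that each of these two choices
-- leaves exactly one assignment.
-- Following the reductions, there are two stable assignments exactly when X contains an odd number of ups and the
-- innermost people of X and Y are both up or both down.
--
-- This criterion is computed by a program of a language whose loops all run along the input list; compiled to WHILE,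
-- such programs take polynomial time.
module Submission where

open import Defs
open import Data.Product using (_×_)
open import Data.Sum using (_⊎_)
open import Relation.Binary.PropositionalEquality using (_≡_)

open import Data.Bool using (Bool; true; false; not; _∧_; _xor_) renaming (if_then_else_ to ifᵇ_then_else_)
open import Data.Bool.Properties
  using (not-injective; not-involutive; not-distribˡ-xor; xor-same; xor-assoc; xor-identityʳ)
open import Data.Empty using (⊥; ⊥-elim)
open import Data.Fin using (Fin; zero; suc; toℕ)
open import Data.Fin.Properties using (_≟_; toℕ-injective; toℕ<n)
open import Data.List as List
  using (List; []; _∷_; _++_; _ʳ++_; length; map; reverse; take; drop; foldl; filter; replicate; allFin)
import Data.List.Properties as Listₚ
open import Data.List.Membership.Propositional using (_∈_)
open import Data.List.Membership.Propositional.Properties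
  using (∈-++⁺ˡ; ∈-++⁺ʳ; ∈-++⁻; ∈-allFin; ∈-cartesianProductWith⁺; ∈-filter⁺; ∈-filter⁻)
open import Data.List.Membership.Propositional.Properties.WithK using (unique∧set⇒bag)
open import Data.List.Relation.Binary.BagAndSetEquality using (∼bag⇒↭)
open import Data.List.Relation.Binary.Permutation.Propositional
  using (_↭_; ↭-refl; ↭-sym; ↭-trans; ↭⇒↭ₛ; prep; swap)
open import Data.List.Relation.Binary.Permutation.Propositional.Properties
  using (∈-resp-↭; ↭-length; shift; ++-comm)
open import Data.List.Relation.Binary.Sublist.Propositional
  using (_⊆_; []; _∷_; _∷ʳ_; from∈; to∈; minimum)
open import Data.List.Relation.Unary.All as All using (All; []; _∷_)
import Data.List.Relation.Unary.All.Properties as Allₚ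
open import Data.List.Relation.Unary.AllPairs as AllPairs using (AllPairs; []; _∷_)
import Data.List.Relation.Unary.AllPairs.Properties as AllPairsₚ
open import Data.List.Relation.Unary.Any using (here; there)
open import Data.List.Relation.Unary.Any.Properties using (reverse⁺; reverse⁻)
open import Data.List.Relation.Unary.Unique.Propositional using (Unique)
import Data.List.Relation.Unary.Unique.Propositional.Properties as Uniqueₚ
open import Data.Nat using (ℕ; zero; suc)
import Data.Nat.Properties as ℕₚ
open import Data.Product using (Σ-syntax; ∃-syntax; _,_; proj₁; proj₂)
open import Data.Sum as Sum using (inj₁; inj₂; [_,_]′)
open import Data.Vec as Vec using (Vec; []; _∷_; lookup; tabulate; _[_]≔_)
import Data.Vec.Properties as Vecₚ
open import Function using (_∘_; flip; case_of_; _⇔_; mk⇔; Equivalence)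
open import Relation.Binary using (DecidableEquality)
open import Relation.Binary.PropositionalEquality
  using (_≢_; refl; sym; ≢-sym; trans; cong; cong₂; subst; subst₂; setoid; module ≡-Reasoning)
open import Relation.Nullary using (¬_; Dec; yes; no)

-- Signs and eventual order of Cauchy sequences

module Reals where

  open import Algebra.Properties.Group using (⁻¹-involutive)
  open import Data.Nat using (_⊔_) renaming (_≤_ to _≤ᴺ_)
  open import Data.Rational
    using (ℚ; 0ℚ; ½; _+_; _*_; _-_; -_; ∣_∣; _≤_; _<_; nonNegative; nonPositive; positive)
  import Data.Rational.Properties as ℚₚ

  infix 4 _<∞_

  -- Unlike `_<ᴿ_`, this asks for no uniform gap, so that a factor of constant sign can be cancelled
  -- index by index. It is still transitive and irreflexive.
  record _<∞_ (s t : ℕ → ℚ) : Set where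
    constructor _,_
    field
      from : ℕ
      less : ∀ n → from ≤ᴺ n → s n < t n

  0∞ : ℕ → ℚ
  0∞ _ = 0ℚ

  <∞-trans : ∀ {s t u} → s <∞ t → t <∞ u → s <∞ u
  <∞-trans (M , p) (N , q) = M ⊔ N , λ n le →
    ℚₚ.<-trans (p n (ℕₚ.≤-trans (ℕₚ.m≤m⊔n M N) le)) (q n (ℕₚ.≤-trans (ℕₚ.m≤n⊔m M N) le))

  <∞-irrefl : ∀ {s} → ¬ s <∞ s
  <∞-irrefl (N , p) = ℚₚ.<-irrefl refl (p N ℕₚ.≤-refl)

  <∞-asym : ∀ {s t} → s <∞ t → ¬ t <∞ s
  <∞-asym p q = <∞-irrefl (<∞-trans p q)

  p≤∣p∣ : ∀ p → p ≤ ∣ p ∣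
  p≤∣p∣ p with ℚₚ._≤?_ 0ℚ p
  ... | yes 0≤p = ℚₚ.≤-reflexive (sym (ℚₚ.0≤p⇒∣p∣≡p 0≤p))
  ... | no  0≰p = ℚₚ.≤-trans (ℚₚ.<⇒≤ (ℚₚ.≰⇒> 0≰p)) (ℚₚ.0≤∣p∣ p)

  half-< : ∀ ε → 0ℚ < ε → ½ * ε < ε
  half-< ε ε>0 = begin-strict
    ½ * ε           ≡⟨ ℚₚ.+-identityʳ (½ * ε) ⟨
    ½ * ε + 0ℚ      <⟨ ℚₚ.+-monoʳ-< (½ * ε) (ℚₚ.positive⁻¹ (½ * ε) {{ℚₚ.pos*pos⇒pos ½ ε {{positive ε>0}}}}) ⟩
    ½ * ε + ½ * ε   ≡⟨ CauchyLemmas.halves ε ⟩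
    ε               ∎
    where open ℚₚ.≤-Reasoning

  -- Triangle inequality for `a * b - a * c`: a gap between the products keeps `∣ a ∣` away from 0.
  gap-bound : ∀ {a b c ε B C} → ∣ b ∣ ≤ B → ∣ c ∣ ≤ C → a * c + ε < a * b → ε < ∣ a ∣ * (B + C)
  gap-bound {a} {b} {c} {ε} {B} {C} b≤B c≤C lt = begin-strict
    ε                                ≡⟨ ℚₚ.+-identityˡ ε ⟨
    0ℚ + ε                           ≡⟨ cong (_+ ε) (ℚₚ.+-inverseˡ (a * c)) ⟨
    (- (a * c) + a * c) + ε          ≡⟨ ℚₚ.+-assoc (- (a * c)) (a * c) ε ⟩
    - (a * c) + (a * c + ε)          <⟨ ℚₚ.+-monoʳ-< (- (a * c)) lt ⟩
    - (a * c) + a * b                ≡⟨ ℚₚ.+-comm (- (a * c)) (a * b) ⟩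
    a * b - a * c                    ≤⟨ p≤∣p∣ _ ⟩
    ∣ a * b - a * c ∣                ≤⟨ ℚₚ.∣p-q∣≤∣p∣+∣q∣ (a * b) (a * c) ⟩
    ∣ a * b ∣ + ∣ a * c ∣            ≡⟨ cong₂ _+_ (ℚₚ.∣p*q∣≡∣p∣*∣q∣ a b) (ℚₚ.∣p*q∣≡∣p∣*∣q∣ a c) ⟩
    ∣ a ∣ * ∣ b ∣ + ∣ a ∣ * ∣ c ∣    ≤⟨ ℚₚ.+-mono-≤ (mono b≤B) (mono c≤C) ⟩
    ∣ a ∣ * B + ∣ a ∣ * C            ≡⟨ ℚₚ.*-distribˡ-+ ∣ a ∣ B C ⟨
    ∣ a ∣ * (B + C)                  ∎
    where
    open ℚₚ.≤-Reasoning
    mono : ∀ {p q} → p ≤ q → ∣ a ∣ * p ≤ ∣ a ∣ * q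
    mono = ℚₚ.*-monoˡ-≤-nonNeg ∣ a ∣ {{ℚₚ.∣-∣-nonNeg a}}

  same-sign⁺ : ∀ {p q δ} → ∣ p - q ∣ < δ → δ ≤ ∣ p ∣ → 0ℚ ≤ p → 0ℚ < q
  same-sign⁺ {p} {q} {δ} close δ≤ 0≤p with ℚₚ._<?_ 0ℚ q
  ... | yes 0<q = 0<q
  ... | no  0≮q = ⊥-elim (ℚₚ.<-irrefl refl (begin-strict
    p            ≡⟨ ℚₚ.+-identityʳ p ⟨
    p + 0ℚ       ≤⟨ ℚₚ.+-monoʳ-≤ p (ℚₚ.neg-antimono-≤ (ℚₚ.≮⇒≥ 0≮q)) ⟩
    p - q        ≤⟨ p≤∣p∣ (p - q) ⟩
    ∣ p - q ∣    <⟨ close ⟩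
    δ            ≤⟨ δ≤ ⟩
    ∣ p ∣        ≡⟨ ℚₚ.0≤p⇒∣p∣≡p 0≤p ⟩
    p            ∎))
    where open ℚₚ.≤-Reasoning

  same-sign⁻ : ∀ {p q δ} → ∣ p - q ∣ < δ → δ ≤ ∣ p ∣ → p ≤ 0ℚ → q < 0ℚ
  same-sign⁻ {p} {q} {δ} close δ≤ p≤0 = subst (_< 0ℚ) (⁻¹-involutive ℚₚ.+-0-group q)
    (ℚₚ.neg-antimono-< (same-sign⁺
      (subst (λ r → r < δ) (trans (sym (ℚₚ.∣-p∣≡∣p∣ (p - q))) (cong ∣_∣ (ℚₚ.neg-distrib-+ p (- q)))) close)
      (subst (δ ≤_) (sym (ℚₚ.∣-p∣≡∣p∣ p)) δ≤) (ℚₚ.neg-antimono-≤ p≤0)))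

  -- A gap between x z and x y bounds |x| away from 0, so x has a sign, and dividing by x orders y and z.
  product-order : ∀ x y z → x *ᴿ z <ᴿ x *ᴿ y →
                  (0∞ <∞ seq x × seq z <∞ seq y) ⊎ (seq x <∞ 0∞ × seq y <∞ seq z)
  product-order x y z (ε , ε>0 , N , lt)
    with CauchyLemmas.eventuallyBounded (seq y) (cauchy y) | CauchyLemmas.eventuallyBounded (seq z) (cauchy z)
  ... | B , B>0 , N₁ , y≤B | C , C>0 , N₂ , z≤C
    -- Here `(B + C) * δ` is `½ * ε`: if `x` were smaller than `δ` in absolute value, `gap-bound`
    -- would give `ε < ½ * ε`. As `x` moves by less than `δ` from then on, it cannot change its
    -- sign.
    with CauchyLemmas.shrink (B + C) (ℚₚ.pos+pos⇒pos B {{B>0}} C {{C>0}}) ε ε>0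
  ... | δ , δ>0 , eq with cauchy x δ δ>0
  ... | N₃ , close = conclude (ℚₚ._≤?_ 0ℚ (seq x M))
    where
    M = (N ⊔ N₁) ⊔ (N₂ ⊔ N₃)
    N≤M  = ℕₚ.≤-trans (ℕₚ.m≤m⊔n N N₁) (ℕₚ.m≤m⊔n (N ⊔ N₁) (N₂ ⊔ N₃))
    N₁≤M = ℕₚ.≤-trans (ℕₚ.m≤n⊔m N N₁) (ℕₚ.m≤m⊔n (N ⊔ N₁) (N₂ ⊔ N₃))
    N₂≤M = ℕₚ.≤-trans (ℕₚ.m≤m⊔n N₂ N₃) (ℕₚ.m≤n⊔m (N ⊔ N₁) (N₂ ⊔ N₃))
    N₃≤M = ℕₚ.≤-trans (ℕₚ.m≤n⊔m N₂ N₃) (ℕₚ.m≤n⊔m (N ⊔ N₁) (N₂ ⊔ N₃))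
    δ≤∣x∣ : δ ≤ ∣ seq x M ∣
    δ≤∣x∣ with ℚₚ._≤?_ δ ∣ seq x M ∣
    ... | yes le = le
    ... | no  ¬le = ⊥-elim (ℚₚ.<-asym (half-< ε ε>0) (begin-strict
      ε                          <⟨ gap-bound {a = seq x M} (y≤B M N₁≤M) (z≤C M N₂≤M) (lt M N≤M) ⟩
      ∣ seq x M ∣ * (B + C)      ≡⟨ ℚₚ.*-comm ∣ seq x M ∣ (B + C) ⟩
      (B + C) * ∣ seq x M ∣      <⟨ ℚₚ.*-monoʳ-<-pos (B + C) {{ℚₚ.pos+pos⇒pos B {{B>0}} C {{C>0}}}} (ℚₚ.≰⇒> ¬le) ⟩
      (B + C) * δ                ≡⟨ eq ⟩
      ½ * ε                      ∎))
      where open ℚₚ.≤-Reasoning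
    near : ∀ n → M ≤ᴺ n → ∣ seq x M - seq x n ∣ < δ
    near n le = close M n N₃≤M (ℕₚ.≤-trans N₃≤M le)
    strict : ∀ n → M ≤ᴺ n → seq x n * seq z n < seq x n * seq y n
    strict n le = begin-strict
      seq x n * seq z n         ≡⟨ ℚₚ.+-identityʳ _ ⟨
      seq x n * seq z n + 0ℚ    <⟨ ℚₚ.+-monoʳ-< (seq x n * seq z n) ε>0 ⟩
      seq x n * seq z n + ε     <⟨ lt n (ℕₚ.≤-trans N≤M le) ⟩
      seq x n * seq y n         ∎
      where open ℚₚ.≤-Reasoning
    conclude : Dec (0ℚ ≤ seq x M) → (0∞ <∞ seq x × seq z <∞ seq y) ⊎ (seq x <∞ 0∞ × seq y <∞ seq z)
    conclude (yes 0≤x) = inj₁ ((M , pos) , M , λ n le →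
      ℚₚ.*-cancelˡ-<-nonNeg (seq x n) {{nonNegative (ℚₚ.<⇒≤ (pos n le))}} (strict n le))
      where
      pos : ∀ n → M ≤ᴺ n → 0ℚ < seq x n
      pos n le = same-sign⁺ (near n le) δ≤∣x∣ 0≤x
    conclude (no 0≰x) = inj₂ ((M , neg) , M , λ n le →
      ℚₚ.*-cancelˡ-<-nonPos (seq x n) {{nonPositive (ℚₚ.<⇒≤ (neg n le))}} (strict n le))
      where
      neg : ∀ n → M ≤ᴺ n → seq x n < 0ℚ
      neg n le = same-sign⁻ (near n le) δ≤∣x∣ (ℚₚ.<⇒≤ (ℚₚ.≰⇒> 0≰x))

open Reals using (_<∞_; 0∞; <∞-trans; <∞-irrefl; <∞-asym; product-order)

open import Data.Nat
  using (_+_; _*_; _∸_; _^_; _⊔_; _≤_; _<_; _≡ᵇ_; pred; z≤n; s≤s; NonZero)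

-- Stable matchings of a set of people

module Matchings {P : Set} (_≟_ : DecidableEquality P)
                 (Pref : P → P → P → Set) (asym : ∀ {x y z} → Pref x y z → ¬ Pref x z y) where

  Blocking : (P → P) → P → P → Set
  Blocking μ x y = x ≢ y × μ x ≢ y × Pref x y (μ x) × Pref y x (μ y)

  -- `μ` is a total function constrained on `M` only, so that the same `μ` can be restricted to a
  -- smaller set. Uniqueness accordingly means agreement on `M`.
  record StableOn (M : List P) (μ : P → P) : Set where
    field
      closed    : ∀ {x} → x ∈ M → μ x ∈ M
      moves     : ∀ {x} → x ∈ M → μ x ≢ x
      invol     : ∀ {x} → x ∈ M → μ (μ x) ≡ x
      unblocked : ∀ {x y} → x ∈ M → y ∈ M → ¬ Blocking μ x y

  open StableOn public

  Agree : List P → (P → P) → (P → P) → Set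
  Agree M μ ν = ∀ {x} → x ∈ M → μ x ≡ ν x

  One Two : List P → Set
  One M = Σ[ ν ∈ (P → P) ] StableOn M ν × (∀ μ → StableOn M μ → Agree M μ ν)
  Two M = Σ[ ν₁ ∈ (P → P) ] Σ[ ν₂ ∈ (P → P) ] StableOn M ν₁ × StableOn M ν₂
        × (∃[ x ] x ∈ M × ν₁ x ≢ ν₂ x)
        × (∀ μ → StableOn M μ → Agree M μ ν₁ ⊎ Agree M μ ν₂)

  -- Indexed by the value of the criterion, so that a single induction carries both possible counts.
  Solutions : Bool → List P → Set
  Solutions false = One
  Solutions true  = Two

  private variable
    a b c x y z : P
    M M₁ M₂ : List P
    μ ν : P → P

  stable-↭ : M₁ ↭ M₂ → StableOn M₁ μ → StableOn M₂ μ
  stable-↭ p st = record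
    { closed    = ∈-resp-↭ p ∘ closed st ∘ ∈-resp-↭ (↭-sym p)
    ; moves     = moves st ∘ ∈-resp-↭ (↭-sym p)
    ; invol     = invol st ∘ ∈-resp-↭ (↭-sym p)
    ; unblocked = λ x∈ y∈ → unblocked st (∈-resp-↭ (↭-sym p) x∈) (∈-resp-↭ (↭-sym p) y∈) }

  solutions-↭ : ∀ t → M₁ ↭ M₂ → Solutions t M₁ → Solutions t M₂
  solutions-↭ false p (ν , st , only) =
    ν , stable-↭ p st , λ μ st′ x∈ → only μ (stable-↭ (↭-sym p) st′) (∈-resp-↭ (↭-sym p) x∈)
  solutions-↭ true p (ν₁ , ν₂ , st₁ , st₂ , (x , x∈ , ≢) , only) =
    ν₁ , ν₂ , stable-↭ p st₁ , stable-↭ p st₂ , (x , ∈-resp-↭ p x∈ , ≢) ,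
    λ μ st → Sum.map (λ ag x∈ → ag (∈-resp-↭ (↭-sym p) x∈)) (λ ag x∈ → ag (∈-resp-↭ (↭-sym p) x∈))
                 (only μ (stable-↭ (↭-sym p) st))

  stable-agree : Agree M ν μ → StableOn M μ → StableOn M ν
  stable-agree {ν = ν} {μ = μ} ag st = record
    { closed    = λ x∈ → subst (_∈ _) (sym (ag x∈)) (closed st x∈)
    ; moves     = λ x∈ → moves st x∈ ∘ trans (sym (ag x∈))
    ; invol     = λ x∈ → trans (cong ν (ag x∈)) (trans (ag (closed st x∈)) (invol st x∈))
    ; unblocked = λ {x} {y} x∈ y∈ (x≢y , νx≢y , p , q) → unblocked st x∈ y∈
        (x≢y , νx≢y ∘ trans (ag x∈) , subst (Pref x y) (ag x∈) p , subst (Pref y x) (ag y∈) q) }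

  blocking-sym : μ (μ y) ≡ y → Blocking μ x y → Blocking μ y x
  blocking-sym {μ = μ} inv (x≢y , μx≢y , p , q) =
    x≢y ∘ sym , (λ μy≡x → μx≢y (trans (cong μ (sym μy≡x)) inv)) , q , p

  partner : StableOn M μ → a ∈ M → μ a ≡ b → μ b ≡ a
  partner {μ = μ} st a∈ eq = trans (cong μ (sym eq)) (invol st a∈)

  pair : P → P → (P → P) → P → P
  pair a b μ x with x ≟ a | x ≟ b
  ... | yes _ | _     = b
  ... | no _  | yes _ = a
  ... | no _  | no _  = μ x

  pair-fst : ∀ a b μ → pair a b μ a ≡ b
  pair-fst a b μ with a ≟ a
  ... | yes _ = refl
  ... | no ¬p = ⊥-elim (¬p refl)

  pair-snd : ∀ a b μ → a ≢ b → pair a b μ b ≡ a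
  pair-snd a b μ a≢b with b ≟ a | b ≟ b
  ... | yes p | _     = ⊥-elim (a≢b (sym p))
  ... | no _  | yes _ = refl
  ... | no _  | no ¬p = ⊥-elim (¬p refl)

  pair-other : ∀ a b μ → x ≢ a → x ≢ b → pair a b μ x ≡ μ x
  pair-other {x = x} a b μ x≢a x≢b with x ≟ a | x ≟ b
  ... | yes p | _     = ⊥-elim (x≢a p)
  ... | no _  | yes p = ⊥-elim (x≢b p)
  ... | no _  | no _  = refl

  restrict : Unique (a ∷ b ∷ M) → StableOn (a ∷ b ∷ M) μ → μ a ≡ b → StableOn M μ
  restrict {a} {b} {M} {μ} ((_ ∷ a∉) ∷ b∉ ∷ _) st eq = record
    { closed    = cl
    ; moves     = moves st ∘ there ∘ there
    ; invol     = invol st ∘ there ∘ there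
    ; unblocked = λ x∈ y∈ → unblocked st (there (there x∈)) (there (there y∈)) }
    where
    cl : ∀ {x} → x ∈ M → μ x ∈ M
    cl x∈ with closed st (there (there x∈))
    ... | there (there p)  = p
    ... | here μx≡a        =
      ⊥-elim (All.lookup b∉ x∈ (trans (sym eq) (partner st (there (there x∈)) μx≡a)))
    ... | there (here μx≡b) = ⊥-elim (All.lookup a∉ x∈ (trans
      (sym (partner st (here refl) eq)) (partner st (there (there x∈)) μx≡b)))

  -- Adding the pair a, b to a stable matching of M creates no blocking pair.
  Harmless : P → P → List P → Set
  Harmless a b M = ∀ {μ y} → StableOn M μ → μ a ≡ b → μ b ≡ a → y ∈ M →
                   ¬ Blocking μ a y × ¬ Blocking μ b y

  extend : a ≢ b → Harmless a b M → StableOn M μ → μ a ≡ b → μ b ≡ a → StableOn (a ∷ b ∷ M) μ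
  extend {a} {b} {M} {μ} a≢b h st ab ba = record
    { closed = cl ; moves = mv ; invol = inv ; unblocked = ub }
    where
    cl : ∀ {x} → x ∈ a ∷ b ∷ M → μ x ∈ a ∷ b ∷ M
    cl (here refl)         = there (here ab)
    cl (there (here refl)) = here ba
    cl (there (there x∈))  = there (there (closed st x∈))
    mv : ∀ {x} → x ∈ a ∷ b ∷ M → μ x ≢ x
    mv (here refl) eq         = a≢b (trans (sym eq) ab)
    mv (there (here refl)) eq = a≢b (trans (sym ba) eq)
    mv (there (there x∈))     = moves st x∈
    inv : ∀ {x} → x ∈ a ∷ b ∷ M → μ (μ x) ≡ x
    inv (here refl)         = trans (cong μ ab) ba
    inv (there (here refl)) = trans (cong μ ba) ab
    inv (there (there x∈))  = invol st x∈
    a-ok : ∀ {y} → y ∈ a ∷ b ∷ M → ¬ Blocking μ a y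
    a-ok (here refl) (≢ , _)             = ≢ refl
    a-ok (there (here refl)) (_ , ≢ , _) = ≢ ab
    a-ok (there (there y∈))              = proj₁ (h st ab ba y∈)
    b-ok : ∀ {y} → y ∈ a ∷ b ∷ M → ¬ Blocking μ b y
    b-ok (here refl) (_ , ≢ , _)     = ≢ ba
    b-ok (there (here refl)) (≢ , _) = ≢ refl
    b-ok (there (there y∈))          = proj₂ (h st ab ba y∈)
    ub : ∀ {x y} → x ∈ a ∷ b ∷ M → y ∈ a ∷ b ∷ M → ¬ Blocking μ x y
    ub (here refl) y∈ = a-ok y∈
    ub (there (here refl)) y∈ = b-ok y∈
    ub (there (there x∈)) (here refl)         = a-ok (there (there x∈)) ∘ blocking-sym (inv (here refl))
    ub (there (there x∈)) (there (here refl)) =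
      b-ok (there (there x∈)) ∘ blocking-sym (inv (there (here refl)))
    ub (there (there x∈)) (there (there y∈))  = unblocked st x∈ y∈

  glue-agree : Unique (a ∷ b ∷ M) → Agree M (pair a b ν) ν
  glue-agree {a} {b} {ν = ν} ((_ ∷ a∉) ∷ b∉ ∷ _) x∈ =
    pair-other a b ν (≢-sym (All.lookup a∉ x∈)) (≢-sym (All.lookup b∉ x∈))

  glue : Unique (a ∷ b ∷ M) → Harmless a b M → StableOn M ν → StableOn (a ∷ b ∷ M) (pair a b ν)
  glue {a} {b} {ν = ν} u@((a≢b ∷ _) ∷ _) h st =
    extend a≢b h (stable-agree (glue-agree u) st) (pair-fst a b ν) (pair-snd a b ν a≢b)

  agree-glue : Unique (a ∷ b ∷ M) → StableOn (a ∷ b ∷ M) μ → μ a ≡ b → Agree M μ ν →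
               Agree (a ∷ b ∷ M) μ (pair a b ν)
  agree-glue {a} {b} {ν = ν} ((a≢b ∷ _) ∷ _) st ab ag (here refl) = trans ab (sym (pair-fst a b ν))
  agree-glue {a} {b} {ν = ν} ((a≢b ∷ _) ∷ _) st ab ag (there (here refl)) =
    trans (partner st (here refl) ab) (sym (pair-snd a b ν a≢b))
  agree-glue u st ab ag (there (there x∈)) = trans (ag x∈) (sym (glue-agree u x∈))

  -- Every stable matching contains the pair, so restricting to `M` and gluing the pair back are
  -- inverse to each other up to agreement, and the number of solutions carries over.
  forced : ∀ t → Unique (a ∷ b ∷ M) → Harmless a b M → (∀ {μ} → StableOn (a ∷ b ∷ M) μ → μ a ≡ b) →
           Solutions t M → Solutions t (a ∷ b ∷ M)
  forced {a} {b} false u h f (ν , st , only) =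
    pair a b ν , glue u h st ,
    λ μ st′ → agree-glue u st′ (f st′) (only μ (restrict u st′ (f st′)))
  forced {a} {b} true u h f (ν₁ , ν₂ , st₁ , st₂ , (x , x∈ , ≢) , only) =
    pair a b ν₁ , pair a b ν₂ , glue u h st₁ , glue u h st₂ ,
    (x , there (there x∈) , λ eq → ≢ (trans (sym (glue-agree u x∈)) (trans eq (glue-agree u x∈)))) ,
    λ μ st → Sum.map (agree-glue u st (f st)) (agree-glue u st (f st)) (only μ (restrict u st (f st)))

  -- The two glued matchings differ at `a`. Any stable matching restricts, depending on the partner
  -- of `a`, to one of the two unique ones.
  branch : Unique (a ∷ b ∷ c ∷ M) → Harmless a b (c ∷ M) → Harmless a c (b ∷ M) →
           (∀ {μ} → StableOn (a ∷ b ∷ c ∷ M) μ → μ a ≡ b ⊎ μ a ≡ c) →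
           One (c ∷ M) → One (b ∷ M) → Two (a ∷ b ∷ c ∷ M)
  branch {a} {b} {c} {M} u@((a≢b ∷ a≢c ∷ a∉) ∷ (b≢c ∷ b∉) ∷ c∉ ∷ u-M) h₁ h₂ f
         (ν₁ , st₁ , only₁) (ν₂ , st₂ , only₂) =
    pair a b ν₁ , pair a c ν₂ , glue u h₁ st₁ , stable-↭ σ (glue u′ h₂ st₂) ,
    (a , here refl , λ eq → b≢c (trans (sym (pair-fst a b ν₁)) (trans eq (pair-fst a c ν₂)))) ,
    λ μ st → Sum.map
      (λ ab → agree-glue u st ab (only₁ μ (restrict u st ab)))
      (λ ac → let st′ = stable-↭ σ st in
              agree-glue u′ st′ ac (only₂ μ (restrict u′ st′ ac)) ∘ ∈-resp-↭ σ)
      (f st)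
    where
    σ : ∀ {x y} → a ∷ x ∷ y ∷ M ↭ a ∷ y ∷ x ∷ M
    σ = prep a (swap _ _ ↭-refl)
    u′ : Unique (a ∷ c ∷ b ∷ M)
    u′ = (a≢c ∷ a≢b ∷ a∉) ∷ (b≢c ∘ sym ∷ c∉) ∷ b∉ ∷ u-M

  nobody : One []
  nobody = (λ x → x) , record { closed = λ () ; moves = λ () ; invol = λ () ; unblocked = λ () } , λ _ _ ()

  two-people : a ≢ b → One (a ∷ b ∷ [])
  two-people {a} {b} a≢b = forced false ((a≢b ∷ []) ∷ [] ∷ []) (λ _ _ _ ()) f nobody
    where
    f : StableOn (a ∷ b ∷ []) μ → μ a ≡ b
    f st with closed st (here refl)
    ... | here eq         = ⊥-elim (moves st (here refl) eq)
    ... | there (here eq) = eq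

  -- Left apart, `a` and `b` would block; once together, neither would leave for anybody else.
  mutual-favourites : ∀ t → Unique (a ∷ b ∷ M) → All (Pref a b) M → All (Pref b a) M →
                      Solutions t M → Solutions t (a ∷ b ∷ M)
  mutual-favourites {a} {b} {M} t u@((a≢b ∷ _) ∷ b∉ ∷ _) a-b b-a = forced t u
    (λ st ab ba y∈ → (λ (_ , _ , p , _) → asym (subst (Pref a _) ab p) (All.lookup a-b y∈))
                   , (λ (_ , _ , p , _) → asym (subst (Pref b _) ba p) (All.lookup b-a y∈))) f
    where
    f : StableOn (a ∷ b ∷ M) μ → μ a ≡ b
    f {μ} st with closed st (here refl) | closed st (there (here refl))
    ... | here eq           | _                 = ⊥-elim (moves st (here refl) eq)
    ... | there (here eq)   | _                 = eq
    ... | there (there _)   | here eq           = partner st (there (here refl)) eq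
    ... | there (there _)   | there (here eq)   = ⊥-elim (moves st (there (here refl)) eq)
    ... | there (there μa∈) | there (there μb∈) = ⊥-elim (unblocked st (here refl) (there (here refl))
      (a≢b , ≢-sym (All.lookup b∉ μa∈) , All.lookup a-b μa∈ , All.lookup b-a μb∈))

  -- `x` is the favourite of `y`, so `y` would accept an offer from `x`.
  snubbed : StableOn M μ → x ∈ M → y ∈ M → x ≢ y → μ x ≢ y → Pref x y (μ x) →
            ¬ (∀ {z} → z ∈ M → z ≢ x → Pref y x z)
  snubbed st x∈ y∈ x≢y μx≢y p fav = unblocked st x∈ y∈
    (x≢y , μx≢y , p , fav (closed st y∈) (λ eq → μx≢y (partner st y∈ eq)))

  -- s ranks b first; b would leave s only for t, who ranks b last.
  harmless-rival : ∀ {s b t M} → All (Pref s b) (t ∷ M) → All (Pref b s) M →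
                   All (λ y → Pref t y b) M → Harmless s b (t ∷ M)
  harmless-rival {s} {b} {t} {M} s-b b-s t-b {μ} st sb bs y∈ = s-ok y∈ , b-ok y∈
    where
    s-ok : ∀ {y} → y ∈ t ∷ M → ¬ Blocking μ s y
    s-ok y∈ (_ , _ , p , _) = asym (subst (Pref s _) sb p) (All.lookup s-b y∈)
    b-ok : ∀ {y} → y ∈ t ∷ M → ¬ Blocking μ b y
    b-ok (there y∈) (_ , _ , p , _) = asym (subst (Pref b _) bs p) (All.lookup b-s y∈)
    b-ok (here refl) (_ , _ , _ , q) with closed st (here refl)
    ... | here eq   = moves st (here refl) eq
    ... | there μt∈ = asym q (All.lookup t-b μt∈)

  -- Only `t` could keep `b` from `s`. But if `b` had `t`, then `t` would prefer `p` to `b`, and `p`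
  -- likes `t` best.
  rival : ∀ {s b t p M} r → Unique (s ∷ b ∷ t ∷ M) →
          All (Pref s b) (t ∷ M) → All (Pref b s) M → All (λ y → Pref t y b) M →
          p ∈ M → All (Pref p t) (s ∷ b ∷ M) →
          Solutions r (t ∷ M) → Solutions r (s ∷ b ∷ t ∷ M)
  rival {s} {b} {t} {p} {M} r u@((s≢b ∷ s≢t ∷ s∉) ∷ (b≢t ∷ b∉) ∷ t∉ ∷ _) s-b b-s t-b p∈ p-t =
    forced r u (harmless-rival s-b b-s t-b) f
    where
    p-μ : ∀ {x} → x ∈ s ∷ b ∷ t ∷ M → x ≢ t → Pref p t x
    p-μ (here refl)                 _ = All.head p-t
    p-μ (there (here refl))         _ = All.head (All.tail p-t)
    p-μ (there (there (here refl))) ≢ = ⊥-elim (≢ refl)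
    p-μ (there (there (there x∈)))  _ = All.lookup (All.tail (All.tail p-t)) x∈
    t-loses : StableOn (s ∷ b ∷ t ∷ M) μ → μ b ≢ t
    t-loses st bt with partner st (there (here refl)) bt
    ... | refl = snubbed st (there (there (here refl))) (there (there (there p∈)))
      (All.lookup t∉ p∈) (All.lookup b∉ p∈) (All.lookup t-b p∈) p-μ
    f : StableOn (s ∷ b ∷ t ∷ M) μ → μ s ≡ b
    f {μ} st with closed st (here refl) | closed st (there (here refl))
    ... | here eq           | _                         = ⊥-elim (moves st (here refl) eq)
    ... | there (here eq)   | _                         = eq
    ... | there (there _)   | here eq                   = partner st (there (here refl)) eq
    ... | there (there _)   | there (here eq)           = ⊥-elim (moves st (there (here refl)) eq)
    ... | there (there _)   | there (there (here eq))   = ⊥-elim (t-loses st eq)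
    ... | there (there μs∈) | there (there (there μb∈)) = ⊥-elim (unblocked st (here refl) (there (here refl))
      (s≢b , (λ eq → All.lookup (b≢t ∷ b∉) μs∈ (sym eq)) , All.lookup s-b μs∈ , All.lookup b-s μb∈))

  -- If `b` had neither `t` nor `s`, it would block with `s`, who likes `b` best. Both choices are
  -- harmless: with `b` and `t` paired, all others prefer their partners to `t`; with `b` and `s`
  -- paired, only `t` could tempt `b`, and `t` prefers its own partner.
  two-ways : ∀ {s b t M} → Unique (b ∷ t ∷ s ∷ M) →
             All (Pref s b) (t ∷ M) → All (Pref b s) M → All (Pref b t) (s ∷ M) →
             All (λ y → Pref t y b) M → AllPairs (λ y z → Pref y z t × Pref z y t) (s ∷ M) →
             One (s ∷ M) → One (t ∷ M) → Two (b ∷ t ∷ s ∷ M)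
  two-ways {s} {b} {t} {M} u@((b≢t ∷ b≢s ∷ b∉) ∷ (t≢s ∷ t∉) ∷ s∉ ∷ _) s-b b-s b-t t-b rest =
    branch u pair-t (λ st bs sb y∈ → let (p , q) = harmless-rival s-b b-s t-b st sb bs y∈ in q , p) f
    where
    apart : ∀ {N} → AllPairs (λ y z → Pref y z t × Pref z y t) N →
            ∀ {x y} → x ∈ N → y ∈ N → x ≢ y → Pref x y t
    apart (_ ∷ _)  (here refl) (here refl) ≢ = ⊥-elim (≢ refl)
    apart (ps ∷ _) (here refl) (there y∈)  _ = proj₁ (All.lookup ps y∈)
    apart (ps ∷ _) (there x∈)  (here refl) _ = proj₂ (All.lookup ps x∈)
    apart (_ ∷ pp) (there x∈)  (there y∈)  ≢ = apart pp x∈ y∈ ≢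
    pair-t : Harmless b t (s ∷ M)
    pair-t st bt tb y∈ =
        (λ (_ , _ , p , _) → asym (subst (Pref b _) bt p) (All.lookup b-t y∈))
      , (λ (_ , _ , _ , q) → asym q (apart rest y∈ (closed st y∈) (≢-sym (moves st y∈))))
    f : StableOn (b ∷ t ∷ s ∷ M) μ → μ b ≡ t ⊎ μ b ≡ s
    f {μ} st with closed st (here refl)
    ... | here eq                 = ⊥-elim (moves st (here refl) eq)
    ... | there (here eq)         = inj₁ eq
    ... | there (there (here eq)) = inj₂ eq
    ... | there (there (there μb∈)) = ⊥-elim (unblocked st (there (there (here refl))) (here refl)
      ( ≢-sym b≢s , (λ sb → All.lookup s∉ μb∈ (sym (partner st (there (there (here refl))) sb)))
      , s-μ (closed st (there (there (here refl)))) , All.lookup b-s μb∈))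
      where
      s-μ : μ s ∈ b ∷ t ∷ s ∷ M → Pref s b (μ s)
      s-μ (here eq)                 =
        ⊥-elim (All.lookup s∉ μb∈ (sym (partner st (there (there (here refl))) eq)))
      s-μ (there (here eq))         = subst (Pref s b) (sym eq) (All.head s-b)
      s-μ (there (there (here eq))) = ⊥-elim (moves st (there (there (here refl))) eq)
      s-μ (there (there (there x∈))) = All.lookup (All.tail s-b) x∈

  -- Apart from `b` and `t`, `s` and `c` like each other best. But `c` cannot get `t`, since `t`
  -- prefers `p` to `c` and is the favourite of `p`; likewise `n` keeps `b` from `s`. Conversely,
  -- once `s` and `c` are paired, `t` or `b` could be tempted by them only if paired with each
  -- other, which `p` excludes again.
  crossing : ∀ {s c t b p n M} r → Unique (s ∷ c ∷ t ∷ b ∷ M) →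
             All (Pref s c) (t ∷ M) → All (Pref c s) (b ∷ M) →
             All (λ y → Pref t y c) M → All (λ y → Pref b y s) M →
             p ∈ M → All (Pref p t) (s ∷ c ∷ b ∷ M) → Pref t p b →
             n ∈ M → All (Pref n b) (s ∷ c ∷ t ∷ M) →
             Solutions r (t ∷ b ∷ M) → Solutions r (s ∷ c ∷ t ∷ b ∷ M)
  crossing {s} {c} {t} {b} {p} {n} {M} r
           u@((s≢c ∷ s≢t ∷ s≢b ∷ s∉) ∷ (c≢t ∷ c≢b ∷ c∉) ∷ (t≢b ∷ t∉) ∷ b∉ ∷ _)
           s-c c-s t-c b-s p∈ p-t t-p n∈ n-b =
    forced r u harmless f
    where
    N = s ∷ c ∷ t ∷ b ∷ M
    p-μ : ∀ {x} → x ∈ N → x ≢ t → Pref p t x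
    p-μ (here refl)                         _ = All.head p-t
    p-μ (there (here refl))                 _ = All.head (All.tail p-t)
    p-μ (there (there (here refl)))         ≢ = ⊥-elim (≢ refl)
    p-μ (there (there (there x∈)))          _ = All.lookup (All.tail (All.tail p-t)) x∈
    n-μ : ∀ {x} → x ∈ N → x ≢ b → Pref n b x
    n-μ (here refl)                         _ = All.head n-b
    n-μ (there (here refl))                 _ = All.head (All.tail n-b)
    n-μ (there (there (here refl)))         _ = All.head (All.tail (All.tail n-b))
    n-μ (there (there (there (here refl)))) ≢ = ⊥-elim (≢ refl)
    n-μ (there (there (there (there x∈))))  _ = All.lookup (All.tail (All.tail (All.tail n-b))) x∈
    tb-apart : StableOn (t ∷ b ∷ M) μ → μ t ≢ b
    tb-apart st refl = snubbed st (here refl) (there (there p∈)) (All.lookup t∉ p∈)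
      (All.lookup b∉ p∈) t-p (λ z∈ → p-μ (there (there z∈)))
    harmless : Harmless s c (t ∷ b ∷ M)
    harmless {μ} st sc cs y∈ = s-ok y∈ , c-ok y∈
      where
      s-ok : ∀ {y} → y ∈ t ∷ b ∷ M → ¬ Blocking μ s y
      s-ok (here refl)         (_ , _ , p , _) = asym (subst (Pref s _) sc p) (All.head s-c)
      s-ok (there (there y∈))  (_ , _ , p , _) =
        asym (subst (Pref s _) sc p) (All.lookup (All.tail s-c) y∈)
      s-ok (there (here refl)) (_ , _ , _ , q) with closed st (there (here refl))
      ... | here eq           = tb-apart st (partner st (there (here refl)) eq)
      ... | there (here eq)   = moves st (there (here refl)) eq
      ... | there (there μb∈) = asym q (All.lookup b-s μb∈)
      c-ok : ∀ {y} → y ∈ t ∷ b ∷ M → ¬ Blocking μ c y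
      c-ok (there y∈)  (_ , _ , p , _) = asym (subst (Pref c _) cs p) (All.lookup c-s y∈)
      c-ok (here refl) (_ , _ , _ , q) with closed st (here refl)
      ... | here eq           = moves st (here refl) eq
      ... | there (here eq)   = tb-apart st eq
      ... | there (there μt∈) = asym q (All.lookup t-c μt∈)
    c≢-μ : StableOn N μ → μ c ≢ t
    c≢-μ st ct with partner st (there (here refl)) ct
    ... | refl = snubbed st (there (there (here refl))) (there (there (there (there p∈))))
      (All.lookup t∉ p∈) (All.lookup c∉ p∈) (All.lookup t-c p∈) p-μ
    s≢-μ : StableOn N μ → μ s ≢ b
    s≢-μ st sb with partner st (here refl) sb
    ... | refl = snubbed st (there (there (there (here refl)))) (there (there (there (there n∈))))
      (All.lookup b∉ n∈) (All.lookup s∉ n∈) (All.lookup b-s n∈) n-μ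
    f : StableOn N μ → μ s ≡ c
    f {μ} st with μ s ≟ c
    ... | yes eq = eq
    ... | no μs≢c = ⊥-elim (unblocked st (here refl) (there (here refl))
      ( s≢c , μs≢c , s-μ (closed st (here refl)) , c-μ (closed st (there (here refl)))))
      where
      s-μ : μ s ∈ N → Pref s c (μ s)
      s-μ (here eq)                         = ⊥-elim (moves st (here refl) eq)
      s-μ (there (here eq))                 = ⊥-elim (μs≢c eq)
      s-μ (there (there (here eq)))         = subst (Pref s c) (sym eq) (All.head s-c)
      s-μ (there (there (there (here eq)))) = ⊥-elim (s≢-μ st eq)
      s-μ (there (there (there (there x∈)))) = All.lookup (All.tail s-c) x∈
      c-μ : μ c ∈ N → Pref c s (μ c)
      c-μ (here eq)                  = ⊥-elim (μs≢c (partner st (there (here refl)) eq))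
      c-μ (there (here eq))          = ⊥-elim (moves st (there (here refl)) eq)
      c-μ (there (there (here eq)))  = ⊥-elim (c≢-μ st eq)
      c-μ (there (there (there x∈))) = All.lookup c-s x∈

  -- `n` likes `b` best, and `b` would leave `n` only for `c`. If `b` had `c`, the partner of `t`
  -- would prefer `c` to `t`, and `c` would prefer that person to `b`.
  sole-rival : ∀ {b n c t M} r → Unique (b ∷ n ∷ c ∷ t ∷ M) →
               All (Pref n b) (c ∷ t ∷ M) → All (Pref b n) (t ∷ M) →
               All (λ y → Pref c y b) (n ∷ t ∷ M) → All (λ y → Pref y c t) (n ∷ M) →
               Solutions r (c ∷ t ∷ M) → Solutions r (b ∷ n ∷ c ∷ t ∷ M)
  sole-rival {b} {n} {c} {t} {M} r
             u@((b≢n ∷ b≢c ∷ b≢t ∷ b∉) ∷ (n≢c ∷ n≢t ∷ n∉) ∷ (c≢t ∷ c∉) ∷ t∉ ∷ _) n-b b-n c-b rest-c-t =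
    forced r u harmless f
    where
    N = b ∷ n ∷ c ∷ t ∷ M
    harmless : Harmless b n (c ∷ t ∷ M)
    harmless st bn nb y∈ with harmless-rival n-b b-n (All.tail c-b) st nb bn y∈
    ... | n-ok , b-ok = b-ok , n-ok
    bc-apart : StableOn N μ → μ b ≢ c
    bc-apart {μ} st bc = unblocked st c∈ μt∈ (c≢μt , cb≢μt , c-μt , t-loses)
      where
      c∈ = there (there (here refl))
      t∈ = there (there (there (here refl)))
      cb : μ c ≡ b
      cb = partner st (here refl) bc
      μt∈ : μ t ∈ N
      μt∈ = closed st t∈
      c≢μt : c ≢ μ t
      c≢μt eq = b≢t (trans (sym cb) (trans (cong μ eq) (invol st t∈)))
      cb≢μt : μ c ≢ μ t
      cb≢μt eq = c≢t (trans (sym (invol st c∈)) (trans (cong μ eq) (invol st t∈)))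
      rest : ∀ {x} → x ∈ N → x ≢ b → x ≢ c → x ≢ t → x ∈ n ∷ M
      rest (here eq)                          ≢ _ _ = ⊥-elim (≢ eq)
      rest (there (here eq))                  _ _ _ = here eq
      rest (there (there (here eq)))          _ ≢ _ = ⊥-elim (≢ eq)
      rest (there (there (there (here eq))))  _ _ ≢ = ⊥-elim (≢ eq)
      rest (there (there (there (there x∈)))) _ _ _ = there x∈
      μt∈′ : μ t ∈ n ∷ M
      μt∈′ = rest μt∈ (λ eq → cb≢μt (trans cb (sym eq))) (≢-sym c≢μt) (moves st t∈)
      weaken : ∀ {x} → x ∈ n ∷ M → x ∈ n ∷ t ∷ M
      weaken (here eq)  = here eq
      weaken (there x∈) = there (there x∈)
      c-μt : Pref c (μ t) (μ c)
      c-μt = subst (Pref c _) (sym cb) (All.lookup c-b (weaken μt∈′))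
      t-loses : Pref (μ t) c (μ (μ t))
      t-loses = subst (Pref (μ t) c) (sym (invol st t∈)) (All.lookup rest-c-t μt∈′)
    f : StableOn N μ → μ b ≡ n
    f {μ} st with μ b ≟ n
    ... | yes eq = eq
    ... | no μb≢n = ⊥-elim (unblocked st (here refl) (there (here refl))
      (b≢n , μb≢n , b-μ (closed st (here refl)) , n-μ (closed st (there (here refl)))))
      where
      b-μ : μ b ∈ N → Pref b n (μ b)
      b-μ (here eq)                  = ⊥-elim (moves st (here refl) eq)
      b-μ (there (here eq))          = ⊥-elim (μb≢n eq)
      b-μ (there (there (here eq)))  = ⊥-elim (bc-apart st eq)
      b-μ (there (there (there x∈))) = All.lookup b-n x∈
      n-μ : μ n ∈ N → Pref n b (μ n)
      n-μ (here eq)          = ⊥-elim (μb≢n (partner st (there (here refl)) eq))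
      n-μ (there (here eq))  = ⊥-elim (moves st (there (here refl)) eq)
      n-μ (there (there x∈)) = All.lookup n-b x∈

unique-↭ : ∀ {A : Set} {xs ys : List A} → xs ↭ ys → Unique xs → Unique ys
unique-↭ {A} p = Unique-resp-↭ (↭⇒↭ₛ p)
  where open import Data.List.Relation.Binary.Permutation.Setoid.Properties (setoid A)

odd : ℕ → Bool
odd zero    = false
odd (suc n) = not (odd n)

same : Bool → Bool → Bool
same true  b = b
same false b = not b

-- People on a line

module Counting {P : Set} (up : P → Bool) where

  ups downs : List P → ℕ
  ups []         = zero
  ups (x ∷ xs)   = ifᵇ up x then suc (ups xs) else ups xs
  downs []       = zero
  downs (x ∷ xs) = ifᵇ up x then downs xs else suc (downs xs)

  -- The seeds used in `two` let an empty `X` count as ending in an up and an empty `Y` as ending in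
  -- a down. So removing the last two ups of `X` or the last two downs of `Y` does not change the
  -- criterion.
  lastUp : Bool → List P → Bool
  lastUp d []       = d
  lastUp d (x ∷ xs) = lastUp (up x) xs

  -- X lists the top part of the line downwards, Y the bottom part upwards.
  two : List P → List P → Bool
  two X Y = odd (ups X) ∧ same (lastUp true X) (lastUp false Y)

  some-up : ∀ {k} xs → ups xs ≡ suc k → ∃[ x ] x ∈ xs × up x ≡ true
  some-up (x ∷ xs) eq with up x in u
  ... | true  = x , here refl , u
  ... | false with some-up xs eq
  ... | y , y∈ , v = y , there y∈ , v

  some-down : ∀ {k} xs → downs xs ≡ suc k → ∃[ x ] x ∈ xs × up x ≡ false
  some-down (x ∷ xs) eq with up x in u
  ... | false = x , here refl , u
  ... | true with some-down xs eq
  ... | y , y∈ , v = y , there y∈ , v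

  all-down : ∀ xs → ups xs ≡ 0 → All (λ x → up x ≡ false) xs
  all-down []       _  = []
  all-down (x ∷ xs) eq with up x in u
  ... | false = u ∷ all-down xs eq

  all-up : ∀ xs → downs xs ≡ 0 → All (λ x → up x ≡ true) xs
  all-up []       _  = []
  all-up (x ∷ xs) eq with up x in u
  ... | true = u ∷ all-up xs eq

  downs-all : ∀ {xs} → All (λ x → up x ≡ false) xs → downs xs ≡ length xs
  downs-all []       = refl
  downs-all (u ∷ us) rewrite u = cong suc (downs-all us)

  ups-all : ∀ {xs} → All (λ x → up x ≡ true) xs → ups xs ≡ length xs
  ups-all []       = refl
  ups-all (u ∷ us) rewrite u = cong suc (ups-all us)

  lastUp-all : ∀ {b xs} → All (λ x → up x ≡ b) xs → lastUp b xs ≡ b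
  lastUp-all []       = refl
  lastUp-all (u ∷ us) rewrite u = lastUp-all us

module Lines {P : Set} (_≟_ : DecidableEquality P)
             (Pref : P → P → P → Set) (asym : ∀ {x y z} → Pref x y z → ¬ Pref x z y) where

  open Matchings _≟_ Pref asym public

  -- u ≺ v: u stands above v.
  record Line : Set₁ where
    infix 4 _≺_
    field
      up        : P → Bool
      _≺_       : P → P → Set
      irrefl    : ∀ {x y} → x ≺ y → x ≢ y
      pref-up   : ∀ {x y z} → up x ≡ true → y ≺ z → Pref x y z
      pref-down : ∀ {x y z} → up x ≡ false → z ≺ y → Pref x y z

    record Split (X Y : List P) : Set where
      pattern
      constructor split
      field
        sortedˣ : AllPairs _≺_ X
        sortedʸ : AllPairs (flip _≺_) Y
        across  : All (λ x → All (x ≺_) Y) X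

    split-unique : ∀ {X Y} → Split X Y → Unique (X ++ Y)
    split-unique (split sX sY a) = AllPairsₚ.++⁺ (AllPairs.map irrefl sX)
      (AllPairs.map (λ lt → ≢-sym (irrefl lt)) sY) (All.map (All.map irrefl) a)

  -- Turning the line over exchanges `X` with `Y` and ups with downs, so that the rules for the
  -- bottom follow from those for the top.
  upside-down : Line → Line
  upside-down L = record
    { up        = not ∘ Line.up L
    ; _≺_       = flip (Line._≺_ L)
    ; irrefl    = ≢-sym ∘ Line.irrefl L
    ; pref-up   = λ u → Line.pref-down L (not-injective u)
    ; pref-down = λ u → Line.pref-up L (not-injective u) }

  module Cases (L : Line) where
    open Line L

    split-tops : ∀ r {t s X Y} → Split (t ∷ s ∷ X) Y → up t ≡ true → up s ≡ true →
                 Solutions r (X ++ Y) → Solutions r ((t ∷ s ∷ X) ++ Y)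
    split-tops r sp@(split ((_ ∷ t≺X) ∷ s≺X ∷ _) _ (t≺Y ∷ s≺Y ∷ _)) ut us =
      mutual-favourites r (split-unique sp)
        (All.map (pref-up ut) (Allₚ.++⁺ s≺X s≺Y)) (All.map (pref-up us) (Allₚ.++⁺ t≺X t≺Y))

    split-ends : ∀ r {t b X Y} → Split (t ∷ X) (b ∷ Y) → up t ≡ false → up b ≡ true →
                 Solutions r (X ++ Y) → Solutions r ((t ∷ X) ++ (b ∷ Y))
    split-ends r {t} {b} {X} {Y} sp@(split (t≺X ∷ _) (Y≺b ∷ _) ((t≺b ∷ t≺Y) ∷ a)) ut ub sol =
      solutions-↭ r σ (mutual-favourites r (unique-↭ (↭-sym σ) (split-unique sp))
        (All.map (pref-down ut) (Allₚ.++⁺ (All.map All.head a) Y≺b))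
        (All.map (pref-up ub) (Allₚ.++⁺ t≺X t≺Y)) sol)
      where
      σ : t ∷ b ∷ X ++ Y ↭ t ∷ X ++ b ∷ Y
      σ = prep t (↭-sym (shift b X Y))

    -- The up `p` ranks the top person `t` first, and the up `t` ranks the bottom person `b` last;
    -- so `b` cannot keep `t`.
    split-rival : ∀ r {t s b p X Y} → Split (t ∷ s ∷ X) (b ∷ Y) →
                  up t ≡ true → up s ≡ false → up b ≡ true → p ∈ X ++ Y → up p ≡ true →
                  Solutions r ((t ∷ X) ++ Y) → Solutions r ((t ∷ s ∷ X) ++ (b ∷ Y))
    split-rival r {t} {s} {b} {p} {X} {Y}
                sp@(split ((t≺s ∷ t≺X) ∷ s≺X ∷ _) (Y≺b ∷ _) ((t≺b ∷ t≺Y) ∷ (s≺b ∷ s≺Y) ∷ a))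
                ut us ub p∈ up-p sol =
      solutions-↭ r σ (rival r (unique-↭ (↭-sym σ) (split-unique sp))
        (All.map (pref-down us) (t≺b ∷ all≺b)) (All.map (pref-up ub) (Allₚ.++⁺ s≺X s≺Y))
        (All.map (pref-up ut) all≺b) p∈
        (All.map (pref-up up-p) (t≺s ∷ t≺b ∷ Allₚ.++⁺ t≺X t≺Y)) sol)
      where
      all≺b : All (_≺ b) (X ++ Y)
      all≺b = Allₚ.++⁺ (All.map All.head a) Y≺b
      σ : s ∷ b ∷ t ∷ X ++ Y ↭ t ∷ s ∷ X ++ b ∷ Y
      σ = ↭-trans (prep s (swap b t ↭-refl))
            (↭-trans (swap s t ↭-refl) (prep t (prep s (↭-sym (shift b X Y)))))

    -- The ends t and b keep s and c from their favourites: b never gets s, t never gets c.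
    split-crossing : ∀ r {t s b c p n X Y} → Split (t ∷ s ∷ X) (b ∷ c ∷ Y) →
                     up t ≡ true → up s ≡ false → up b ≡ false → up c ≡ true →
                     p ∈ X ++ Y → up p ≡ true → n ∈ X ++ Y → up n ≡ false →
                     Solutions r ((t ∷ X) ++ (b ∷ Y)) → Solutions r ((t ∷ s ∷ X) ++ (b ∷ c ∷ Y))
    split-crossing r {t} {s} {b} {c} {p} {n} {X} {Y}
      sp@(split ((t≺s ∷ t≺X) ∷ s≺X ∷ _) ((c≺b ∷ Y≺b) ∷ Y≺c ∷ _)
                ((t≺b ∷ t≺c ∷ t≺Y) ∷ (s≺b ∷ s≺c ∷ s≺Y) ∷ a))
      ut us ub uc p∈ up-p n∈ un sol =
      solutions-↭ r σ (crossing r (unique-↭ (↭-sym σ) (split-unique sp))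
        (All.map (pref-down us) (t≺c ∷ all≺c)) (All.map (pref-up uc) (s≺b ∷ s≺all))
        (All.map (pref-up ut) all≺c) (All.map (pref-down ub) s≺all)
        p∈ (All.map (pref-up up-p) (t≺s ∷ t≺c ∷ t≺b ∷ Allₚ.++⁺ t≺X t≺Y))
        (pref-up ut (All.lookup all≺b p∈))
        n∈ (All.map (pref-down un) (s≺b ∷ c≺b ∷ t≺b ∷ all≺b))
        (solutions-↭ r (prep t (shift b X Y)) sol))
      where
      all≺b : All (_≺ b) (X ++ Y)
      all≺b = Allₚ.++⁺ (All.map All.head a) Y≺b
      all≺c : All (_≺ c) (X ++ Y)
      all≺c = Allₚ.++⁺ (All.map (All.head ∘ All.tail) a) Y≺c
      s≺all : All (s ≺_) (X ++ Y)
      s≺all = Allₚ.++⁺ s≺X s≺Y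
      σ : s ∷ c ∷ t ∷ b ∷ X ++ Y ↭ t ∷ s ∷ X ++ b ∷ c ∷ Y
      σ = ↭-trans (prep s (swap c t ↭-refl)) (↭-trans (swap s t ↭-refl) (prep t (prep s
            (↭-trans (swap c b ↭-refl) (↭-trans (prep b (↭-sym (shift c X Y)))
              (↭-sym (shift b X (c ∷ Y))))))))

    -- `Y` is listed upwards, so `y₁` and `y₂` are the two lowest people; being downs, they are each
    -- other's favourites. The odd length finally leaves exactly one down for `z`.
    chain : ∀ {z} Y → AllPairs (flip _≺_) Y → All (λ y → up y ≡ false) Y → All (z ≺_) Y →
            odd (length Y) ≡ true → One (z ∷ Y)
    chain (y ∷ []) _ _ (z≺y ∷ []) _ = two-people (irrefl z≺y)
    chain {z} (y₁ ∷ y₂ ∷ Y) sY@((y₂≺y₁ ∷ Y≺y₁) ∷ Y≺y₂ ∷ sY′) (u₁ ∷ u₂ ∷ us) z≺@(z≺y₁ ∷ z≺y₂ ∷ z≺Y) o =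
      solutions-↭ false σ (mutual-favourites false
        (unique-↭ (↭-sym σ) (All.map irrefl z≺ ∷ AllPairs.map (λ lt → ≢-sym (irrefl lt)) sY))
        (All.map (pref-down u₁) (z≺y₂ ∷ Y≺y₂)) (All.map (pref-down u₂) (z≺y₁ ∷ Y≺y₁))
        (chain Y sY′ us z≺Y (trans (sym (not-involutive (odd (length Y)))) o)))
      where
      σ : y₁ ∷ y₂ ∷ z ∷ Y ↭ z ∷ y₁ ∷ y₂ ∷ Y
      σ = ↭-trans (prep y₁ (swap y₂ z ↭-refl)) (swap y₁ z ↭-refl)

    -- `b` may take `t` or `s`; the other one then stands above an odd number of downs, which is a
    -- `chain`.
    end-two-ways : ∀ {t s b Y} → Split (t ∷ s ∷ []) (b ∷ Y) → up s ≡ false → up t ≡ true → up b ≡ true →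
                   All (λ y → up y ≡ false) Y → odd (length Y) ≡ true → Two (t ∷ s ∷ b ∷ Y)
    end-two-ways {t} {s} {b} {Y}
                 sp@(split ((t≺s ∷ []) ∷ _) (Y≺b ∷ sY) ((t≺b ∷ t≺Y) ∷ (s≺b ∷ s≺Y) ∷ [])) us ut ub uY o =
      solutions-↭ true σ (two-ways (unique-↭ (↭-sym σ) (split-unique sp))
        (All.map (pref-down us) (t≺b ∷ Y≺b)) (All.map (pref-up ub) s≺Y)
        (All.map (pref-up ub) (t≺s ∷ t≺Y)) (All.map (pref-up ut) Y≺b)
        (apart (us ∷ uY) (t≺s ∷ t≺Y))
        (chain Y sY uY s≺Y o) (chain Y sY uY t≺Y o))
      where
      apart : ∀ {N} → All (λ y → up y ≡ false) N → All (t ≺_) N →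
              AllPairs (λ y z → Pref y z t × Pref z y t) N
      apart []        []         = []
      apart (u ∷ us′) (lt ∷ lts) =
        All.zipWith (λ (u′ , lt′) → pref-down u lt′ , pref-down u′ lt) (us′ , lts) ∷ apart us′ lts
      σ : b ∷ t ∷ s ∷ Y ↭ t ∷ s ∷ b ∷ Y
      σ = ↭-trans (swap b t ↭-refl) (prep t (swap b s ↭-refl))

    -- The partner of `t` would be a down, and every down prefers `c` to the top person `t`; this
    -- keeps `c` from `b`. Pairing `b` with `n` leaves the situation of `end-two-ways`, with `c` as
    -- the up at the bottom.
    split-sole-rival : ∀ {t s b c n Y} → Split (t ∷ s ∷ []) (b ∷ c ∷ n ∷ Y) →
                       up t ≡ true → up s ≡ false → up b ≡ false → up c ≡ true → up n ≡ false →
                       All (λ y → up y ≡ false) Y → odd (length Y) ≡ true →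
                       Two (t ∷ s ∷ b ∷ c ∷ n ∷ Y)
    split-sole-rival {t} {s} {b} {c} {n} {Y}
      sp@(split (( t≺s ∷ []) ∷ _) ((c≺b ∷ n≺b ∷ Y≺b) ∷ (n≺c ∷ Y≺c) ∷ Y≺n ∷ sY)
                ((t≺b ∷ t≺c ∷ t≺n ∷ t≺Y) ∷ (s≺b ∷ s≺c ∷ s≺n ∷ s≺Y) ∷ []))
      ut us ub uc un uY o =
      solutions-↭ true σ (sole-rival true (unique-↭ (↭-sym σ) (split-unique sp))
        (All.map (pref-down un) (c≺b ∷ t≺b ∷ s≺b ∷ Y≺b))
        (All.map (pref-down ub) (t≺n ∷ s≺n ∷ Y≺n))
        (All.map (pref-up uc) (n≺b ∷ t≺b ∷ s≺b ∷ Y≺b))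
        (All.map (λ u → pref-down u t≺c) (un ∷ us ∷ uY))
        (solutions-↭ true τ
          (end-two-ways (split ((t≺s ∷ []) ∷ [] ∷ []) (Y≺c ∷ sY) ((t≺c ∷ t≺Y) ∷ (s≺c ∷ s≺Y) ∷ []))
                        us ut uc uY o)))
      where
      τ : t ∷ s ∷ c ∷ Y ↭ c ∷ t ∷ s ∷ Y
      τ = ↭-trans (prep t (swap s c ↭-refl)) (swap t c ↭-refl)
      σ : b ∷ n ∷ c ∷ t ∷ s ∷ Y ↭ t ∷ s ∷ b ∷ c ∷ n ∷ Y
      σ = ↭-trans (shift t (b ∷ n ∷ c ∷ []) (s ∷ Y)) (prep t (↭-trans (shift s (b ∷ n ∷ c ∷ []) Y)
            (prep s (prep b (swap n c ↭-refl)))))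

    -- `sole-rival` with `s` in the role of `n`: if `b` had `c`, and hence `s` had `t`, then `s` and
    -- `c` would block. So `b` takes `s`, which leaves `c` and `t` to each other.
    split-four : ∀ {t s b c} → Split (t ∷ s ∷ []) (b ∷ c ∷ []) →
                 up t ≡ true → up s ≡ false → up b ≡ false → up c ≡ true → One (t ∷ s ∷ b ∷ c ∷ [])
    split-four {t} {s} {b} {c}
      sp@(split ((t≺s ∷ []) ∷ _) ((c≺b ∷ []) ∷ _) ((t≺b ∷ t≺c ∷ []) ∷ (s≺b ∷ s≺c ∷ []) ∷ [])) ut us ub uc =
      solutions-↭ false σ (sole-rival false (unique-↭ (↭-sym σ) (split-unique sp))
        (All.map (pref-down us) (c≺b ∷ t≺b ∷ [])) (pref-down ub t≺s ∷ [])
        (All.map (pref-up uc) (s≺b ∷ t≺b ∷ [])) (pref-down us t≺c ∷ [])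
        (two-people (≢-sym (irrefl t≺c))))
      where
      σ : b ∷ s ∷ c ∷ t ∷ [] ↭ t ∷ s ∷ b ∷ c ∷ []
      σ = ↭-trans (shift t (b ∷ s ∷ c ∷ []) []) (prep t (swap b s ↭-refl))

  module Solve (L : Line) where
    open Line L
    open Cases L
    open Counting up
    module Down = Cases (upside-down L)

    mirror : ∀ {X Y} → Split X Y → Line.Split (upside-down L) Y X
    mirror (split sX sY a) = Line.split sY sX (Allₚ.All-swap a)

    sign : ∀ x → up x ≡ true ⊎ up x ≡ false
    sign x with up x
    ... | true  = inj₁ refl
    ... | false = inj₂ refl

    no-twice : ∀ {a b} → a ≡ not (not b) → a ≡ b
    no-twice {b = b} eq = trans eq (not-involutive b)

    odd-length-downs : ∀ Y → ups Y ≡ 0 → odd (downs Y) ≡ true → odd (length Y) ≡ true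
    odd-length-downs Y eq o = trans (cong odd (sym (downs-all (all-down Y eq)))) o

    odd-length-ups : ∀ X → downs X ≡ 0 → odd (ups X) ≡ true → odd (length X) ≡ true
    odd-length-ups X eq o = trans (cong odd (sym (ups-all (all-up X eq)))) o

    -- The seed `true` is an up in front of `Y`. An odd number of downs is at least one, which
    -- overrides the seed.
    lastUp-odd-downs : ∀ Y → ups Y ≡ 0 → odd (downs Y) ≡ true → lastUp true Y ≡ false
    lastUp-odd-downs (y ∷ Y) eq _ with all-down (y ∷ Y) eq
    ... | u ∷ us rewrite u = lastUp-all us

    lastUp-odd-ups : ∀ X → downs X ≡ 0 → odd (ups X) ≡ true → lastUp false X ≡ true
    lastUp-odd-ups (x ∷ X) eq _ with all-up (x ∷ X) eq
    ... | u ∷ us rewrite u = lastUp-all us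

    when-even : ∀ {o b b′ M} → o ≡ false → Solutions (o ∧ b) M → Solutions (o ∧ b′) M
    when-even refl sol = sol

    -- The first equation says that `X` has as many people as there are ups altogether, so that the
    -- cut is in place. Given this, the second one says that the number of people is even.
    Goal : List P → List P → Set
    Goal X Y = downs X ≡ ups Y → odd (ups X) ≡ odd (downs Y) → Solutions (two X Y) (X ++ Y)

    tops : ∀ {t s X Y} → Split (t ∷ s ∷ X) Y → up t ≡ true → up s ≡ true →
           Goal X Y → Goal (t ∷ s ∷ X) Y
    tops {t} {s} {X} {Y} sp ut us rec eq par = split-tops (two (t ∷ s ∷ X) Y) sp ut us sol
      where
      sol : Solutions (two (t ∷ s ∷ X) Y) (X ++ Y)
      sol rewrite ut | us | not-involutive (odd (ups X)) = rec eq par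

    bottoms : ∀ {b c X Y} → Split X (b ∷ c ∷ Y) → up b ≡ false → up c ≡ false →
              Goal X Y → Goal X (b ∷ c ∷ Y)
    bottoms {b} {c} {X} {Y} sp ub uc rec eq par = solutions-↭ r (++-comm _ X)
      (Down.split-tops r (mirror sp) (cong not ub) (cong not uc) (solutions-↭ r (++-comm X Y) sol))
      where
      r = two X (b ∷ c ∷ Y)
      sol : Solutions r (X ++ Y)
      sol rewrite ub | uc = rec eq (no-twice par)

    ends : ∀ {t b X Y} → Split (t ∷ X) (b ∷ Y) → up t ≡ false → up b ≡ true →
           Goal X Y → Goal (t ∷ X) (b ∷ Y)
    ends {t} {b} {X} {Y} sp ut ub rec eq par = split-ends (two (t ∷ X) (b ∷ Y)) sp ut ub (sol X Y rec eq par)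
      where
      sol : ∀ X Y → Goal X Y → downs (t ∷ X) ≡ ups (b ∷ Y) → odd (ups (t ∷ X)) ≡ odd (downs (b ∷ Y)) →
            Solutions (two (t ∷ X) (b ∷ Y)) (X ++ Y)
      sol []      Y       rec eq par rewrite ut | ub = rec (cong pred eq) par
      sol (_ ∷ _) (_ ∷ _) rec eq par rewrite ut | ub = rec (cong pred eq) par
      -- Emptying `Y` resets its innermost direction from up to the default down. But the removed
      -- `b` was no down, so by parity `X` has an even number of ups and the criterion is false
      -- before and after.
      sol (x ∷ X) []      rec eq par rewrite ut | ub = when-even par (rec (cong pred eq) par)

    rivals : ∀ {t s x b X Y} → Split (t ∷ s ∷ x ∷ X) (b ∷ Y) →
             up t ≡ true → up s ≡ false → up b ≡ true →
             Goal (t ∷ x ∷ X) Y → Goal (t ∷ s ∷ x ∷ X) (b ∷ Y)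
    rivals {t} {s} {x} {b} {X} {Y} sp ut us ub rec eq par with other
      where
      other : ∃[ p ] p ∈ (x ∷ X) ++ Y × up p ≡ true
      other with sign x
      ... | inj₁ ux = x , here refl , ux
      -- With two downs `s` and `x` in the top part, the bottom part has a second up besides `b`.
      ... | inj₂ ux rewrite ut | us | ub | ux with some-up Y (sym (cong pred eq))
      ... | p , p∈ , up-p = p , there (∈-++⁺ʳ X p∈) , up-p
    ... | p , p∈ , up-p = split-rival (two (t ∷ s ∷ x ∷ X) (b ∷ Y)) sp ut us ub p∈ up-p (sol Y rec eq par)
      where
      sol : ∀ Y → Goal (t ∷ x ∷ X) Y → downs (t ∷ s ∷ x ∷ X) ≡ ups (b ∷ Y) →
            odd (ups (t ∷ s ∷ x ∷ X)) ≡ odd (downs (b ∷ Y)) →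
            Solutions (two (t ∷ s ∷ x ∷ X) (b ∷ Y)) ((t ∷ x ∷ X) ++ Y)
      sol (_ ∷ _) rec eq par rewrite ut | us | ub = rec (cong pred eq) par
      sol []      rec eq par rewrite ut | us | ub = when-even par (rec (cong pred eq) par)

    rivals-below : ∀ {t b c y X Y} → Split (t ∷ X) (b ∷ c ∷ y ∷ Y) →
                   up t ≡ false → up b ≡ false → up c ≡ true →
                   Goal X (b ∷ y ∷ Y) → Goal (t ∷ X) (b ∷ c ∷ y ∷ Y)
    rivals-below {t} {b} {c} {y} {X} {Y} sp ut ub uc rec eq par with other
      where
      other : ∃[ n ] n ∈ (y ∷ Y) ++ X × up n ≡ false
      other with sign y
      ... | inj₂ uy = y , here refl , uy
      ... | inj₁ uy rewrite ut | ub | uc | uy with some-down X (cong pred eq)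
      ... | n , n∈ , un = n , there (∈-++⁺ʳ Y n∈) , un
    ... | n , n∈ , un = solutions-↭ r (++-comm _ (t ∷ X))
        (Down.split-rival r (mirror sp) (cong not ub) (cong not uc) (cong not ut) n∈ (cong not un)
          (solutions-↭ r (++-comm X (b ∷ y ∷ Y)) (sol X rec eq par)))
      where
      r = two (t ∷ X) (b ∷ c ∷ y ∷ Y)
      sol : ∀ X → Goal X (b ∷ y ∷ Y) → downs (t ∷ X) ≡ ups (b ∷ c ∷ y ∷ Y) →
            odd (ups (t ∷ X)) ≡ odd (downs (b ∷ c ∷ y ∷ Y)) →
            Solutions (two (t ∷ X) (b ∷ c ∷ y ∷ Y)) (X ++ b ∷ y ∷ Y)
      sol []      rec eq par rewrite ut | ub | uc = rec (cong pred eq) par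
      sol (_ ∷ _) rec eq par rewrite ut | ub | uc = rec (cong pred eq) par

    crossings : ∀ {t s x b c y X Y} → Split (t ∷ s ∷ x ∷ X) (b ∷ c ∷ y ∷ Y) →
                up t ≡ true → up s ≡ false → up b ≡ false → up c ≡ true →
                Goal (t ∷ x ∷ X) (b ∷ y ∷ Y) → Goal (t ∷ s ∷ x ∷ X) (b ∷ c ∷ y ∷ Y)
    crossings {t} {s} {x} {b} {c} {y} {X} {Y} sp ut us ub uc rec eq par =
      let p , p∈ , up-p = other-up
          n , n∈ , un   = other-down
      in split-crossing (two (t ∷ s ∷ x ∷ X) (b ∷ c ∷ y ∷ Y)) sp ut us ub uc p∈ up-p n∈ un sol
      where
      other-up : ∃[ p ] p ∈ (x ∷ X) ++ y ∷ Y × up p ≡ true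
      other-up with sign x
      ... | inj₁ ux = x , here refl , ux
      ... | inj₂ ux rewrite ut | us | ub | uc | ux with some-up (y ∷ Y) (sym (cong pred eq))
      ... | p , p∈ , up-p = p , there (∈-++⁺ʳ X p∈) , up-p
      other-down : ∃[ n ] n ∈ (x ∷ X) ++ y ∷ Y × up n ≡ false
      other-down with sign y
      ... | inj₂ uy = y , ∈-++⁺ʳ (x ∷ X) (here refl) , uy
      ... | inj₁ uy rewrite ut | us | ub | uc | uy with some-down (x ∷ X) (cong pred eq)
      ... | n , n∈ , un = n , ∈-++⁺ˡ n∈ , un
      sol : Solutions (two (t ∷ s ∷ x ∷ X) (b ∷ c ∷ y ∷ Y)) ((t ∷ x ∷ X) ++ b ∷ y ∷ Y)
      sol rewrite ut | us | ub | uc = rec (cong pred eq) par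

    -- By balance, `b` is the only up of the bottom part. By parity, the number of downs behind it
    -- is odd, hence positive, so the innermost person there is a down, like `s`.
    fork : ∀ {t s b Y} → Split (t ∷ s ∷ []) (b ∷ Y) → up t ≡ true → up s ≡ false → up b ≡ true →
           Goal (t ∷ s ∷ []) (b ∷ Y)
    fork {t} {s} {b} {Y} sp ut us ub eq par rewrite ut | us | ub
      | lastUp-odd-downs Y (sym (cong pred eq)) (sym par) =
      end-two-ways sp us ut ub (all-down Y (sym (cong pred eq)))
        (odd-length-downs Y (sym (cong pred eq)) (sym par))

    fork-below : ∀ {t b c X} → Split (t ∷ X) (b ∷ c ∷ []) → up t ≡ false → up b ≡ false → up c ≡ true →
                 Goal (t ∷ X) (b ∷ c ∷ [])
    fork-below {t} {b} {c} {X} sp ut ub uc eq par rewrite ut | ub | uc | par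
      | lastUp-odd-ups X (cong pred eq) par =
      solutions-↭ true (++-comm (b ∷ c ∷ []) (t ∷ X))
        (Down.end-two-ways (mirror sp) (cong not uc) (cong not ub) (cong not ut)
          (All.map (cong not) (all-up X (cong pred eq))) (odd-length-ups X (cong pred eq) par))

    four : ∀ {t s b c} → Split (t ∷ s ∷ []) (b ∷ c ∷ []) →
           up t ≡ true → up s ≡ false → up b ≡ false → up c ≡ true → Goal (t ∷ s ∷ []) (b ∷ c ∷ [])
    four sp ut us ub uc eq par rewrite ut | us | ub | uc = split-four sp ut us ub uc

    -- By balance, `c` is the only up of the bottom part, and by parity the number of downs behind
    -- `n` is odd.
    sole : ∀ {t s b c n Y} → Split (t ∷ s ∷ []) (b ∷ c ∷ n ∷ Y) →
           up t ≡ true → up s ≡ false → up b ≡ false → up c ≡ true → Goal (t ∷ s ∷ []) (b ∷ c ∷ n ∷ Y)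
    sole {n = n} {Y} sp ut us ub uc eq par rewrite ut | us | ub | uc
      with all-down (n ∷ Y) (sym (cong pred eq))
    ... | un ∷ uY rewrite un | lastUp-all {false} uY =
      split-sole-rival sp ut us ub uc un uY (trans (cong odd (sym (downs-all uY))) (sym (no-twice par)))

    sole-below : ∀ {t s x b c X} → Split (t ∷ s ∷ x ∷ X) (b ∷ c ∷ []) →
                 up t ≡ true → up s ≡ false → up b ≡ false → up c ≡ true →
                 Goal (t ∷ s ∷ x ∷ X) (b ∷ c ∷ [])
    sole-below {t} {s} {x} {b} {c} {X} sp ut us ub uc eq par rewrite ut | us | ub | uc
      with all-up (x ∷ X) (cong pred eq)
    ... | ux ∷ uX rewrite ux | lastUp-all {true} uX | par =
      solutions-↭ true (++-comm (b ∷ c ∷ []) (t ∷ s ∷ x ∷ X))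
        (Down.split-sole-rival (mirror sp) (cong not ub) (cong not uc) (cong not ut) (cong not us)
          (cong not ux) (All.map (cong not) uX)
          (trans (cong odd (sym (ups-all uX))) (trans (sym (not-involutive _)) par)))

    last-pair : ∀ {t b} → Split (t ∷ []) (b ∷ []) → up t ≡ true → up b ≡ false → Goal (t ∷ []) (b ∷ [])
    last-pair (split _ _ ((t≺b ∷ []) ∷ [])) ut ub _ _ rewrite ut | ub = two-people (irrefl t≺b)

    -- Vacuous cases of the induction: balance forbids an up in `Y` when `X` has no downs, and
    -- conversely in `unbalanced-down`.
    unbalanced-up : ∀ X Y {y} → downs X ≡ 0 → y ∈ Y → up y ≡ true → Goal X Y
    unbalanced-up _ _ d y∈ uy eq _ = case trans (sym uy) (All.lookup (all-down _ (trans (sym eq) d)) y∈) of λ ()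

    unbalanced-down : ∀ X Y {x} → ups Y ≡ 0 → x ∈ X → up x ≡ false → Goal X Y
    unbalanced-down _ _ u x∈ ux eq _ = case trans (sym ux) (All.lookup (all-up _ (trans eq u)) x∈) of λ ()

    downs-single : ∀ {t} → up t ≡ true → downs (t ∷ []) ≡ 0
    downs-single ut rewrite ut = refl

    ups-single : ∀ {b} → up b ≡ false → ups (b ∷ []) ≡ 0
    ups-single ub rewrite ub = refl

    lone-top : ∀ {t} → up t ≡ true → Goal (t ∷ []) []
    lone-top ut _ par rewrite ut = case par of λ ()

    lone-bottom : ∀ {b} → up b ≡ false → Goal [] (b ∷ [])
    lone-bottom ub _ par rewrite ub = case par of λ ()

    Recursive : List P → List P → Set
    Recursive X Y = ∀ X′ Y′ → length X′ + length Y′ < length X + length Y → Split X′ Y′ → Goal X′ Y′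

    -- The directions of the two outermost people on either side decide which reduction applies.
    -- Sides too short for a reduction are final configurations or contradict balance or parity.
    step : ∀ X Y → Recursive X Y → Split X Y → Goal X Y
    step [] [] _ _ _ _ = nobody
    step [] (b ∷ Y) rec sp with sign b
    ... | inj₁ ub = unbalanced-up [] (b ∷ Y) refl (here refl) ub
    step [] (b ∷ []) rec sp | inj₂ ub = lone-bottom ub
    step [] (b ∷ c ∷ Y) rec sp@(split _ (_ ∷ _ ∷ sY) _) | inj₂ ub with sign c
    ... | inj₁ uc = unbalanced-up [] (b ∷ c ∷ Y) refl (there (here refl)) uc
    ... | inj₂ uc = bottoms sp ub uc (rec [] Y (s≤s (ℕₚ.n≤1+n _)) (split [] sY []))
    step (t ∷ X) [] rec sp with sign t
    ... | inj₂ ut = unbalanced-down (t ∷ X) [] refl (here refl) ut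
    step (t ∷ []) [] rec sp | inj₁ ut = lone-top ut
    step (t ∷ s ∷ X) [] rec sp@(split (_ ∷ _ ∷ sX) _ (_ ∷ _ ∷ a)) | inj₁ ut with sign s
    ... | inj₁ us = tops sp ut us (rec X [] (s≤s (ℕₚ.n≤1+n _)) (split sX [] a))
    ... | inj₂ us = unbalanced-down (t ∷ s ∷ X) [] refl (there (here refl)) us
    step (t ∷ X) (b ∷ Y) rec sp with sign t | sign b
    step (t ∷ X) (b ∷ Y) rec sp@(split (_ ∷ sX) (_ ∷ sY) (_ ∷ a)) | inj₂ ut | inj₁ ub =
      ends sp ut ub (rec X Y (ℕₚ.+-mono-≤-< (ℕₚ.n≤1+n _) ℕₚ.≤-refl) (split sX sY (All.map All.tail a)))
    step (t ∷ X) (b ∷ []) rec sp | inj₂ ut | inj₂ ub =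
      unbalanced-down (t ∷ X) (b ∷ []) (ups-single ub) (here refl) ut
    step (t ∷ X) (b ∷ c ∷ Y) rec sp | inj₂ ut | inj₂ ub with sign c
    step (t ∷ X) (b ∷ c ∷ Y) rec sp@(split sX (_ ∷ _ ∷ sY) a)
      | inj₂ ut | inj₂ ub | inj₂ uc =
      bottoms sp ub uc (rec (t ∷ X) Y (ℕₚ.+-monoʳ-< (length (t ∷ X)) (s≤s (ℕₚ.n≤1+n _)))
        (split sX sY (All.map (All.tail ∘ All.tail) a)))
    step (t ∷ X) (b ∷ c ∷ []) rec sp | inj₂ ut | inj₂ ub | inj₁ uc = fork-below sp ut ub uc
    step (t ∷ X) (b ∷ c ∷ y ∷ Y) rec sp@(split (_ ∷ sX) ((_ ∷ Y≺b) ∷ _ ∷ sY) (_ ∷ a))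
      | inj₂ ut | inj₂ ub | inj₁ uc =
      rivals-below sp ut ub uc
        (rec X (b ∷ y ∷ Y) (ℕₚ.+-mono-≤-< (ℕₚ.n≤1+n _) ℕₚ.≤-refl)
          (split sX (Y≺b ∷ sY) (All.map (λ { (p ∷ _ ∷ ps) → p ∷ ps }) a)))
    step (t ∷ []) (b ∷ Y) rec sp | inj₁ ut | inj₁ ub =
      unbalanced-up (t ∷ []) (b ∷ Y) (downs-single ut) (here refl) ub
    step (t ∷ []) (b ∷ []) rec sp | inj₁ ut | inj₂ ub = last-pair sp ut ub
    step (t ∷ []) (b ∷ c ∷ Y) rec sp | inj₁ ut | inj₂ ub with sign c
    ... | inj₁ uc = unbalanced-up (t ∷ []) (b ∷ c ∷ Y) (downs-single ut) (there (here refl)) uc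
    step (t ∷ []) (b ∷ c ∷ Y) rec sp@(split sX (_ ∷ _ ∷ sY) a)
      | inj₁ ut | inj₂ ub | inj₂ uc =
      bottoms sp ub uc (rec (t ∷ []) Y (ℕₚ.+-monoʳ-< (length (t ∷ [])) (s≤s (ℕₚ.n≤1+n _)))
        (split sX sY (All.map (All.tail ∘ All.tail) a)))
    step (t ∷ s ∷ X) (b ∷ Y) rec sp | inj₁ ut | sb with sign s
    step (t ∷ s ∷ X) (b ∷ Y) rec sp@(split (_ ∷ _ ∷ sX) sY (_ ∷ _ ∷ a)) | inj₁ ut | sb | inj₁ us =
      tops sp ut us (rec X (b ∷ Y) (s≤s (ℕₚ.n≤1+n _)) (split sX sY a))
    step (t ∷ s ∷ []) (b ∷ Y) rec sp | inj₁ ut | inj₁ ub | inj₂ us = fork sp ut us ub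
    step (t ∷ s ∷ x ∷ X) (b ∷ Y) rec sp@(split ((_ ∷ t≺X) ∷ _ ∷ sX) (_ ∷ sY) (a₁ ∷ _ ∷ a))
      | inj₁ ut | inj₁ ub | inj₂ us =
      rivals sp ut us ub
        (rec (t ∷ x ∷ X) Y (ℕₚ.+-mono-≤-< (ℕₚ.n≤1+n (length (t ∷ x ∷ X))) ℕₚ.≤-refl)
          (split (t≺X ∷ sX) sY (All.map All.tail (a₁ ∷ a))))
    step (t ∷ s ∷ X) (b ∷ []) rec sp | inj₁ ut | inj₂ ub | inj₂ us =
      unbalanced-down (t ∷ s ∷ X) (b ∷ []) (ups-single ub) (there (here refl)) us
    step (t ∷ s ∷ X) (b ∷ c ∷ Y) rec sp | inj₁ ut | inj₂ ub | inj₂ us with sign c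
    step (t ∷ s ∷ X) (b ∷ c ∷ Y) rec sp@(split sX (_ ∷ _ ∷ sY) a)
      | inj₁ ut | inj₂ ub | inj₂ us | inj₂ uc =
      bottoms sp ub uc (rec (t ∷ s ∷ X) Y (ℕₚ.+-monoʳ-< (length (t ∷ s ∷ X)) (s≤s (ℕₚ.n≤1+n _)))
        (split sX sY (All.map (All.tail ∘ All.tail) a)))
    step (t ∷ s ∷ []) (b ∷ c ∷ []) rec sp | inj₁ ut | inj₂ ub | inj₂ us | inj₁ uc =
      four sp ut us ub uc
    step (t ∷ s ∷ []) (b ∷ c ∷ y ∷ Y) rec sp | inj₁ ut | inj₂ ub | inj₂ us | inj₁ uc =
      sole sp ut us ub uc
    step (t ∷ s ∷ x ∷ X) (b ∷ c ∷ []) rec sp | inj₁ ut | inj₂ ub | inj₂ us | inj₁ uc =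
      sole-below sp ut us ub uc
    step (t ∷ s ∷ x ∷ X) (b ∷ c ∷ y ∷ Y) rec
          sp@(split ((_ ∷ t≺X) ∷ _ ∷ sX) ((_ ∷ Y≺b) ∷ _ ∷ sY) (a₁ ∷ _ ∷ a))
      | inj₁ ut | inj₂ ub | inj₂ us | inj₁ uc =
      crossings sp ut us ub uc (rec (t ∷ x ∷ X) (b ∷ y ∷ Y) (ℕₚ.+-mono-≤-< (ℕₚ.n≤1+n (length (t ∷ x ∷ X))) ℕₚ.≤-refl)
        (split (t≺X ∷ sX) (Y≺b ∷ sY) (All.map (λ { (p ∷ _ ∷ ps) → p ∷ ps }) (a₁ ∷ a))))

    solve-below : ∀ k X Y → length X + length Y < k → Split X Y → Goal X Y
    solve-below (suc k) X Y (s≤s le) = step X Y (λ X′ Y′ lt → solve-below k X′ Y′ (ℕₚ.≤-trans lt le))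

    solve : ∀ X Y → Split X Y → Goal X Y
    solve X Y = solve-below _ X Y ℕₚ.≤-refl

-- Counting stable assignments

same-members : ∀ {A : Set} {xs ys : List A} → Unique xs → Unique ys → (∀ {z} → z ∈ xs ⇔ z ∈ ys) → xs ↭ ys
same-members u v eq = ∼bag⇒↭ (unique∧set⇒bag u v eq)

∈-allVectors : ∀ {m k} (v : Vec (Fin m) k) → v ∈ allVectors m k
∈-allVectors []      = here refl
∈-allVectors (x ∷ v) = ∈-cartesianProductWith⁺ _∷_ (∈-allFin x) (∈-allVectors v)

allVectors-unique : ∀ m k → Unique (allVectors m k)
allVectors-unique m zero    = [] ∷ []
allVectors-unique m (suc k) =
  Uniqueₚ.cartesianProductWith⁺ _∷_ Vecₚ.∷-injective (Uniqueₚ.allFin⁺ m) (allVectors-unique m k)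

-- In a blocking pair, each member, its partner and the other member are three distinct people, so
-- it suffices that `Pref` agrees with the lists on distinct triples.
module _ {n : ℕ} (I : Roommates n) (Pref : Person n → Person n → Person n → Set)
         (asym : ∀ {x y z} → Pref x y z → ¬ Pref x z y)
         (prefers : ∀ {x y z} → x ≢ y → x ≢ z → y ≢ z → Prefers I x y z ⇔ Pref x y z)
         {L : List (Person n)} (everyone : ∀ x → x ∈ L) where

  open Matchings _≟_ Pref asym

  stable⇒ : ∀ v → IsStableAssignment I v → StableOn L (lookup v)
  stable⇒ v (assignment , unblock) = record
    { closed    = λ _ → everyone _
    ; moves     = λ {x} _ → proj₁ (assignment x)
    ; invol     = λ {x} _ → proj₂ (assignment x)
    ; unblocked = λ {x} {y} _ _ (x≢y , vx≢y , p , q) → unblock x y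
        ( x≢y , vx≢y
        , Equivalence.from (prefers x≢y (≢-sym (proj₁ (assignment x))) (≢-sym vx≢y)) p
        , Equivalence.from (prefers (≢-sym x≢y) (≢-sym (proj₁ (assignment y)))
            (λ x≡vy → vx≢y (trans (cong (lookup v) x≡vy) (proj₂ (assignment y))))) q) }

  stable⇐ : ∀ v → StableOn L (lookup v) → IsStableAssignment I v
  stable⇐ v st = assignment , λ x y (x≢y , vx≢y , p , q) → unblocked st (everyone x) (everyone y)
        ( x≢y , vx≢y
        , Equivalence.to (prefers x≢y (≢-sym (proj₁ (assignment x))) (≢-sym vx≢y)) p
        , Equivalence.to (prefers (≢-sym x≢y) (≢-sym (proj₁ (assignment y)))
            (λ x≡vy → vx≢y (trans (cong (lookup v) x≡vy) (proj₂ (assignment y))))) q)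
    where
    assignment : IsAssignment v
    assignment x = moves st (everyone x) , invol st (everyone x)

  stableList : List (Vec (Person n) (2 * n))
  stableList = filter (isStableAssignment? I) (allVectors _ _)

  stable-tabulate : ∀ {ν} → StableOn L ν → tabulate ν ∈ stableList
  stable-tabulate {ν} st = ∈-filter⁺ (isStableAssignment? I) (∈-allVectors _)
    (stable⇐ (tabulate ν) (stable-agree (λ {x} _ → Vecₚ.lookup∘tabulate ν x) st))

  -- Two duplicate-free lists with the same members are permutations of each other, hence equally
  -- long.
  count-by : ∀ {vs} → Unique vs → (∀ {w} → w ∈ vs → w ∈ stableList) →
             (∀ {w} → StableOn L (lookup w) → w ∈ vs) → countStable I ≡ length vs
  count-by u sound complete = ↭-length (same-members
    (Uniqueₚ.filter⁺ (isStableAssignment? I) (allVectors-unique _ _)) u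
    (λ {w} → mk⇔
      (λ w∈ → complete (stable⇒ w (proj₂ (∈-filter⁻ (isStableAssignment? I) {xs = allVectors _ _} w∈))))
      sound))

  agree⇒≡ : ∀ {w ν} → Agree L (lookup w) ν → w ≡ tabulate ν
  agree⇒≡ {w} ag = trans (sym (Vecₚ.tabulate∘lookup w)) (Vecₚ.tabulate-cong (λ x → ag (everyone x)))

  count : ∀ b → Solutions b L → countStable I ≡ (ifᵇ b then 2 else 1)
  count false (ν , st , only) = count-by {vs = tabulate ν ∷ []} ([] ∷ [])
    (λ { (here refl) → stable-tabulate st })
    (λ {w} st′ → here (agree⇒≡ (only (lookup w) st′)))
  count true (ν₁ , ν₂ , st₁ , st₂ , (x , _ , differ) , only) = count-by {vs = tabulate ν₁ ∷ tabulate ν₂ ∷ []}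
    ((ν₁≢ν₂ ∷ []) ∷ [] ∷ [])
    (λ { (here refl) → stable-tabulate st₁ ; (there (here refl)) → stable-tabulate st₂ })
    (λ {w} st → [ here ∘ agree⇒≡ , there ∘ here ∘ agree⇒≡ ]′ (only (lookup w) st))
    where
    ν₁≢ν₂ : tabulate ν₁ ≢ tabulate ν₂
    ν₁≢ν₂ eq = differ (trans (sym (Vecₚ.lookup∘tabulate ν₁ x))
                   (trans (cong (λ v → lookup v x) eq) (Vecₚ.lookup∘tabulate ν₂ x)))

-- Sorted lists

private variable
  A B : Set
  x y z : A
  xs ys : List A

allPairs-⊆ : (xs : List A) → AllPairs (λ y z → y ∷ z ∷ [] ⊆ xs) xs
allPairs-⊆ []       = []
allPairs-⊆ (x ∷ xs) = All.tabulate (λ z∈ → refl ∷ from∈ z∈) ∷ AllPairs.map (x ∷ʳ_) (allPairs-⊆ xs)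

pair-⊆-total : y ∈ xs → z ∈ xs → y ≢ z → y ∷ z ∷ [] ⊆ xs ⊎ z ∷ y ∷ [] ⊆ xs
pair-⊆-total (here refl) (here refl) y≢z = ⊥-elim (y≢z refl)
pair-⊆-total (here refl) (there z∈)  _   = inj₁ (refl ∷ from∈ z∈)
pair-⊆-total (there y∈)  (here refl) _   = inj₂ (refl ∷ from∈ y∈)
pair-⊆-total {xs = x ∷ _} (there y∈) (there z∈) y≢z with pair-⊆-total y∈ z∈ y≢z
... | inj₁ p = inj₁ (x ∷ʳ p)
... | inj₂ p = inj₂ (x ∷ʳ p)

pair-⊆-distinct : Unique xs → y ∷ z ∷ [] ⊆ xs → y ∈ xs × z ∈ xs × y ≢ z
pair-⊆-distinct (x∉ ∷ u) (_ ∷ʳ p) with pair-⊆-distinct u p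
... | y∈ , z∈ , y≢z = there y∈ , there z∈ , y≢z
pair-⊆-distinct (x∉ ∷ u) (refl ∷ p) = here refl , there (to∈ p) , All.lookup x∉ (to∈ p)

reverse-sorted : ∀ {R : A → A → Set} → AllPairs R xs → AllPairs (flip R) (reverse xs)
reverse-sorted []                      = []
reverse-sorted {xs = x ∷ xs} {R} (r ∷ rs) =
  subst (AllPairs (flip R)) (sym (Listₚ.unfold-reverse x xs))
    (AllPairsₚ.++⁺ (reverse-sorted rs) ([] ∷ []) (All.tabulate (λ y∈ → All.lookup r (reverse⁻ y∈) ∷ [])))

lastOr : A → List A → A
lastOr = foldl (λ _ x → x)

lastOr-map : ∀ (f : A → B) d xs → lastOr (f d) (map f xs) ≡ f (lastOr d xs)
lastOr-map f d []       = refl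
lastOr-map f d (x ∷ xs) = lastOr-map f x xs

lastOr-∈ : ∀ (x : A) xs → lastOr x xs ∈ x ∷ xs
lastOr-∈ x []       = here refl
lastOr-∈ x (y ∷ xs) = there (lastOr-∈ y xs)

sorted-lastOr : ∀ {R : A → A → Set} → AllPairs R (x ∷ xs) → y ∈ x ∷ xs → y ≡ lastOr x xs ⊎ R y (lastOr x xs)
sorted-lastOr {xs = []}     _        (here eq)  = inj₁ eq
sorted-lastOr {xs = x ∷ xs} (r ∷ _)  (here refl) = inj₂ (All.lookup r (lastOr-∈ x xs))
sorted-lastOr {xs = x ∷ xs} (_ ∷ rs) (there y∈) = sorted-lastOr rs y∈

sorted-head : ∀ {R : A → A → Set} → AllPairs R (x ∷ xs) → y ∈ x ∷ xs → y ≡ x ⊎ R x y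
sorted-head _       (here eq)  = inj₁ eq
sorted-head (r ∷ _) (there y∈) = inj₂ (All.lookup r y∈)

-- Reading the line off the preference lists

row : List (List ℕ) → ℕ → List ℕ
row []         _       = []
row (r ∷ rows) zero    = r
row (r ∷ rows) (suc i) = row rows i

first : List ℕ → ℕ
first []      = 0
first (x ∷ _) = x

headOr : A → List A → A
headOr d []      = d
headOr d (x ∷ _) = x

trues : List Bool → ℕ
trues []           = 0
trues (true ∷ bs)  = suc (trues bs)
trues (false ∷ bs) = trues bs

bitsOf : List (List ℕ) → ℕ → List ℕ → List Bool
bitsOf table end = map (λ z → first (row table z) ≡ᵇ end)

orient : Bool → List Bool → List Bool
orient b bits = b ∷ (ifᵇ b then bits else reverse bits)

-- Let the interior person be up; then `interior` begins with the top person and ends with the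
-- bottom person. The top person is up exactly if it ranks the bottom person last, and anybody else
-- is up exactly if the top person comes first. The list of the top person gives the order of the
-- others, from below if that person is down.
wordFrom : List (List ℕ) → List ℕ → List Bool
wordFrom table interior = orient (lastOr 0 row₁ ≡ᵇ lastOr 0 interior) (bitsOf table (first interior) row₁)
  where row₁ = row table (first interior)

-- The second entry of a list is an interior person, whose own list runs from one end of the line to the other.
-- The word is read from the end that this person likes best, as if this person were up.
word : List (List ℕ) → List Bool
word table = wordFrom table (row table (first (drop 1 (row table 0))))

-- The cut comes after as many letters as there are ups. The bottom part is read upwards, so its
-- innermost person is the first letter after the cut.
twoBits : List Bool → Bool
twoBits bs = odd (trues (take k bs)) ∧ same (lastOr true (take k bs)) (headOr false (drop k bs))
  where k = trues bs

answer : List (List ℕ) → Bool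
answer table = twoBits (word table)

table : ∀ {n} → Roommates n → List (List ℕ)
table I = map (λ x → map toℕ (prefs I x)) (allFin _)

row-table : ∀ {n} (I : Roommates n) x → row (table I) (toℕ x) ≡ map toℕ (prefs I x)
row-table I x = go _ _ x
  where
  go : ∀ {A : Set} {m} (f : A → List ℕ) (g : Fin m → A) (x : Fin m) →
       row (map f (List.tabulate g)) (toℕ x) ≡ f (g x)
  go f g zero    = refl
  go f g (suc x) = go f (g ∘ suc) x

≡ᵇ-true : ∀ {m} {x y : Fin m} → x ≡ y → (toℕ x ≡ᵇ toℕ y) ≡ true
≡ᵇ-true {y = y} refl = go (toℕ y)
  where
  go : ∀ k → (k ≡ᵇ k) ≡ true
  go zero    = refl
  go (suc k) = go k

≡ᵇ-false : ∀ {m} {x y : Fin m} → x ≢ y → (toℕ x ≡ᵇ toℕ y) ≡ false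
≡ᵇ-false {x = x} {y} x≢y = go (toℕ x) (toℕ y) (x≢y ∘ toℕ-injective)
  where
  go : ∀ i j → i ≢ j → (i ≡ᵇ j) ≡ false
  go zero    zero    ≢ = ⊥-elim (≢ refl)
  go zero    (suc j) _ = refl
  go (suc i) zero    _ = refl
  go (suc i) (suc j) ≢ = go i j (≢ ∘ cong suc)

-- Directions and positions from the one-attribute model

module _ {n : ℕ} (I : Roommates n) where

  ∈-prefs : ∀ {x y} → y ≢ x → y ∈ prefs I x
  ∈-prefs = Equivalence.from (complete I _ _)

  prefs-≢ : ∀ {x y} → y ∈ prefs I x → y ≢ x
  prefs-≢ = Equivalence.to (complete I _ _)

  everyone-once : ∀ x → x ∷ prefs I x ↭ allFin (2 * n)
  everyone-once x = same-members
    (All.tabulate (λ y∈ → ≢-sym (prefs-≢ y∈)) ∷ unique I x) (Uniqueₚ.allFin⁺ _)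
    (λ {z} → mk⇔ (λ _ → ∈-allFin z) (λ _ → back z))
    where
    back : ∀ z → z ∈ x ∷ prefs I x
    back z with z ≟ x
    ... | yes eq = here eq
    ... | no  ≢  = there (∈-prefs ≢)

  length-prefs : ∀ x → suc (length (prefs I x)) ≡ 2 * n
  length-prefs x = trans (↭-length (everyone-once x)) (Listₚ.length-tabulate (λ y → y))

  -- Abstracts from real numbers: `up` stands for the sign of the preference value, and `≺` compares
  -- position values. That `≺` is total on the people is read off the preference lists.
  record Positions : Set₁ where
    infix 4 _≺_
    field
      up           : Person n → Bool
      _≺_          : Person n → Person n → Set
      ≺-trans      : ∀ {x y z} → x ≺ y → y ≺ z → x ≺ z
      ≺-irrefl     : ∀ {x} → ¬ x ≺ x
      prefers-up   : ∀ {x y z} → up x ≡ true → Prefers I x y z → y ≺ z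
      prefers-down : ∀ {x y z} → up x ≡ false → Prefers I x y z → z ≺ y

  -- Negating all preference and position values leaves every product unchanged.
  turned : Positions → Positions
  turned ps = record
    { up           = not ∘ up
    ; _≺_          = flip _≺_
    ; ≺-trans      = flip ≺-trans
    ; ≺-irrefl     = ≺-irrefl
    ; prefers-up   = prefers-down ∘ not-injective
    ; prefers-down = prefers-up ∘ not-injective }
    where open Positions ps

  module _ (model : OneAttributeModel I) where
    open OneAttributeModel model

    Order : Person n → Person n → Person n → Set
    Order x y z = (0∞ <∞ seq (preference x) × seq (position z) <∞ seq (position y))
                ⊎ (seq (preference x) <∞ 0∞ × seq (position y) <∞ seq (position z))

    prefers⇒order : ∀ {x y z} → Prefers I x y z → Order x y z
    prefers⇒order {x} {y} {z} p with pair-⊆-distinct (unique I x) p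
    ... | y∈ , z∈ , y≢z = product-order (preference x) (position y) (position z)
      (Equivalence.to (induces x y z (≢-sym (prefs-≢ y∈)) (≢-sym (prefs-≢ z∈)) y≢z) p)

    Sign : Person n → Set
    Sign x = 0∞ <∞ seq (preference x) ⊎ seq (preference x) <∞ 0∞

    -- The sign of a real number is not decidable in general. But the first two entries in the list
    -- of `x` are separated by a strict inequality of products, which reveals the sign of the common
    -- factor.
    signed : ∀ {x l} → prefs I x ≡ l → 2 ≤ length l → Sign x
    signed {l = y ∷ []}    _  (s≤s ())
    signed {x} {y ∷ z ∷ l} eq _ =
      Sum.map proj₁ proj₁ (prefers⇒order (subst (y ∷ z ∷ [] ⊆_) (sym eq) (refl ∷ refl ∷ minimum l)))

    isUp : ∀ {x} → Sign x → Bool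
    isUp (inj₁ _) = true
    isUp (inj₂ _) = false

    up-pos : ∀ {x y z} (s : Sign x) → isUp {x} s ≡ true → Order x y z → seq (position z) <∞ seq (position y)
    up-pos _         _ (inj₁ (_ , lt))  = lt
    up-pos (inj₁ 0<x) _ (inj₂ (x<0 , _)) = ⊥-elim (<∞-asym 0<x x<0)

    down-neg : ∀ {x y z} (s : Sign x) → isUp {x} s ≡ false → Order x y z → seq (position y) <∞ seq (position z)
    down-neg _         _ (inj₂ (_ , lt))  = lt
    down-neg (inj₂ x<0) _ (inj₁ (0<x , _)) = ⊥-elim (<∞-asym 0<x x<0)

    positions : (∀ x → 2 ≤ length (prefs I x)) → Positions
    positions long = record
      { up           = λ x → isUp {x} (sign x)
      ; _≺_          = λ y z → seq (position z) <∞ seq (position y)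
      ; ≺-trans      = λ p q → <∞-trans q p
      ; ≺-irrefl     = <∞-irrefl
      ; prefers-up   = λ {x} {y} {z} u p → up-pos {x} {y} {z} (sign x) u (prefers⇒order p)
      ; prefers-down = λ {x} {y} {z} u p → down-neg {x} {y} {z} (sign x) u (prefers⇒order p) }
      where
      sign : ∀ x → Sign x
      sign x = signed {x} refl (long x)

-- The ends of the line and its reading

module _ {n : ℕ} (I : Roommates n) (ps : Positions I) where
  open Positions ps

  prefs-up : ∀ {x} → up x ≡ true → AllPairs _≺_ (prefs I x)
  prefs-up u = AllPairs.map (prefers-up u) (allPairs-⊆ _)

  prefs-down : ∀ {x} → up x ≡ false → AllPairs (flip _≺_) (prefs I x)
  prefs-down u = AllPairs.map (prefers-down u) (allPairs-⊆ _)

  module _ {o a i c t s} {l₀ lᵢ lₜ} (o≡0 : toℕ o ≡ 0)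
           (eq₀ : prefs I o ≡ a ∷ i ∷ c ∷ l₀) (eqᵢ : prefs I i ≡ t ∷ lᵢ) (eqₜ : prefs I t ≡ s ∷ lₜ)
           (up-i : up i ≡ true) where

    m : Person n
    m = lastOr t lᵢ

    sortedᵢ : AllPairs _≺_ (t ∷ lᵢ)
    sortedᵢ = subst (AllPairs _≺_) eqᵢ (prefs-up up-i)

    ∈ᵢ : ∀ {y} → y ≢ i → y ∈ t ∷ lᵢ
    ∈ᵢ = subst (_ ∈_) eqᵢ ∘ ∈-prefs I

    -- `i` stands between `a` and `c`, its neighbours in the list of `o`. Hence the list of `i`,
    -- from which only `i` is missing, runs from one end of the whole line to the other.
    between : (∃[ u ] u ≺ i) × (∃[ v ] i ≺ v)
    between with up o in up-o
    ... | true with subst (AllPairs _≺_) eq₀ (prefs-up up-o)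
    ... | (a≺i ∷ _) ∷ (i≺c ∷ _) ∷ _ = (a , a≺i) , (c , i≺c)
    between | false with subst (AllPairs (flip _≺_)) eq₀ (prefs-down up-o)
    ... | (i≺a ∷ _) ∷ (c≺i ∷ _) ∷ _ = (c , c≺i) , (a , i≺a)

    ≺⇒≢ : ∀ {x y} → x ≺ y → x ≢ y
    ≺⇒≢ lt refl = ≺-irrefl lt

    t≺i : t ≺ i
    t≺i with proj₁ between
    ... | u , u≺i with sorted-head sortedᵢ (∈ᵢ (≺⇒≢ u≺i))
    ... | inj₁ refl = u≺i
    ... | inj₂ t≺u  = ≺-trans t≺u u≺i

    i≺m : i ≺ m
    i≺m with proj₂ between
    ... | v , i≺v with sorted-lastOr sortedᵢ (∈ᵢ (≢-sym (≺⇒≢ i≺v)))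
    ... | inj₁ refl = i≺v
    ... | inj₂ v≺m  = ≺-trans i≺v v≺m

    t-top : ∀ {y} → y ≢ t → t ≺ y
    t-top {y} y≢t with y ≟ i
    ... | yes refl = t≺i
    ... | no  y≢i with sorted-head sortedᵢ (∈ᵢ y≢i)
    ... | inj₁ y≡t = ⊥-elim (y≢t y≡t)
    ... | inj₂ t≺y = t≺y

    m-bottom : ∀ {y} → y ≡ m ⊎ y ≺ m
    m-bottom {y} with y ≟ i
    ... | yes refl = inj₂ i≺m
    ... | no  y≢i  = sorted-lastOr sortedᵢ (∈ᵢ y≢i)

    ∈ₜ : ∀ {y} → y ≢ t → y ∈ s ∷ lₜ
    ∈ₜ = subst (_ ∈_) eqₜ ∘ ∈-prefs I

    ≢t : ∀ {y} → y ∈ s ∷ lₜ → y ≢ t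
    ≢t = prefs-≢ I ∘ subst (_ ∈_) (sym eqₜ)

    -- An up `t` lists the bottom person `m` last. A down `t` lists the highest of the others last,
    -- who is `i` or stands above `i`, hence is not `m`.
    same-end : (toℕ (lastOr s lₜ) ≡ᵇ toℕ m) ≡ up t
    same-end with up t in up-t
    ... | true = ≡ᵇ-true last≡m
      where
      last≡m : lastOr s lₜ ≡ m
      last≡m with sorted-lastOr (subst (AllPairs _≺_) eqₜ (prefs-up up-t)) (∈ₜ (≢-sym (≺⇒≢ (≺-trans t≺i i≺m))))
      ... | inj₁ eq = sym eq
      ... | inj₂ m≺last with m-bottom {lastOr s lₜ}
      ... | inj₁ eq     = eq
      ... | inj₂ last≺m = ⊥-elim (≺-irrefl (≺-trans m≺last last≺m))
    ... | false = ≡ᵇ-false last≢m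
      where
      last≢m : lastOr s lₜ ≢ m
      last≢m eq with sorted-lastOr (subst (AllPairs (flip _≺_)) eqₜ (prefs-down up-t)) (∈ₜ (≢-sym (≺⇒≢ t≺i)))
      ... | inj₁ i≡last = ≺⇒≢ i≺m (trans i≡last eq)
      ... | inj₂ last≺i = ≺-irrefl (≺-trans i≺m (subst (_≺ i) eq last≺i))

    -- An up ranks the top person `t` first. A down `z` differs from `i` and so has `i` on its list;
    -- its first choice is `i` or stands below `i`, hence is not `t`.
    first-choice : ∀ {z} → z ≢ t → (first (row (table I) (toℕ z)) ≡ᵇ toℕ t) ≡ up z
    first-choice {z} z≢t rewrite row-table I z with prefs I z in eq-z | ∈-prefs I {z} {t} (≢-sym z≢t)
    ... | h ∷ l | t∈ with up z in up-z
    ... | true = ≡ᵇ-true h≡t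
      where
      h≡t : h ≡ t
      h≡t with sorted-head (subst (AllPairs _≺_) eq-z (prefs-up up-z)) t∈
      ... | inj₁ t≡h = sym t≡h
      ... | inj₂ h≺t with h ≟ t
      ... | yes h≡t = h≡t
      ... | no  h≢t = ⊥-elim (≺-irrefl (≺-trans h≺t (t-top h≢t)))
    ... | false = ≡ᵇ-false h≢t
      where
      i∈ : i ∈ h ∷ l
      i∈ = subst (i ∈_) eq-z (∈-prefs I (λ i≡z → case trans (sym up-i) (trans (cong up i≡z) up-z) of λ ()))
      h≢t : h ≢ t
      h≢t refl with sorted-head (subst (AllPairs (flip _≺_)) eq-z (prefs-down up-z)) i∈
      ... | inj₁ refl = ≺-irrefl t≺i
      ... | inj₂ i≺t  = ≺-irrefl (≺-trans t≺i i≺t)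

    others : List (Person n)
    others = ifᵇ up t then s ∷ lₜ else reverse (s ∷ lₜ)

    others-sorted : AllPairs _≺_ others
    others-sorted with up t in up-t
    ... | true  = subst (AllPairs _≺_) eqₜ (prefs-up up-t)
    ... | false = reverse-sorted (subst (AllPairs (flip _≺_)) eqₜ (prefs-down up-t))

    ∈-others : ∀ {y} → y ≢ t → y ∈ others
    ∈-others y≢t with up t
    ... | true  = ∈ₜ y≢t
    ... | false = reverse⁺ (∈ₜ y≢t)

    others-≢t : ∀ {y} → y ∈ others → y ≢ t
    others-≢t y∈ with up t
    ... | true  = ≢t y∈
    ... | false = ≢t (reverse⁻ y∈)

    lineup : List (Person n)
    lineup = t ∷ others

    lineup-sorted : AllPairs _≺_ lineup
    lineup-sorted = All.tabulate (t-top ∘ others-≢t) ∷ others-sorted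

    ∈-lineup : ∀ y → y ∈ lineup
    ∈-lineup y with y ≟ t
    ... | yes eq = here eq
    ... | no  ≢  = there (∈-others ≢)

    orient-up : orient (up t) (map up (s ∷ lₜ)) ≡ map up lineup
    orient-up with up t
    ... | true  = refl
    ... | false = cong (_ ∷_) (sym (Listₚ.reverse-map up (s ∷ lₜ)))

    word-lineup : word (table I) ≡ map up lineup
    word-lineup = begin
      wordFrom (table I) (row (table I) (first (drop 1 (row (table I) 0))))
        ≡⟨ cong (λ r → wordFrom (table I) (row (table I) (first (drop 1 r)))) row₀ ⟩
      wordFrom (table I) (row (table I) (toℕ i))
        ≡⟨ cong (wordFrom (table I)) (trans (row-table I i) (cong (map toℕ) eqᵢ)) ⟩
      wordFrom (table I) (map toℕ (t ∷ lᵢ))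
        ≡⟨ cong (λ r → orient (lastOr 0 r ≡ᵇ lastOr (toℕ t) (map toℕ lᵢ)) (bitsOf (table I) (toℕ t) r))
                (trans (row-table I t) (cong (map toℕ) eqₜ)) ⟩
      orient (lastOr (toℕ s) (map toℕ lₜ) ≡ᵇ lastOr (toℕ t) (map toℕ lᵢ))
             (bitsOf (table I) (toℕ t) (map toℕ (s ∷ lₜ)))
        ≡⟨ cong₂ orient (trans (cong₂ _≡ᵇ_ (lastOr-map toℕ s lₜ) (lastOr-map toℕ t lᵢ)) same-end) bits ⟩
      orient (up t) (map up (s ∷ lₜ))
        ≡⟨ orient-up ⟩
      map up lineup ∎
      where
      open ≡-Reasoning
      row₀ : row (table I) 0 ≡ map toℕ (a ∷ i ∷ c ∷ l₀)
      row₀ = trans (cong (row (table I)) (sym o≡0)) (trans (row-table I o) (cong (map toℕ) eq₀))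
      bits : bitsOf (table I) (toℕ t) (map toℕ (s ∷ lₜ)) ≡ map up (s ∷ lₜ)
      bits = trans (sym (Listₚ.map-∘ (s ∷ lₜ)))
        (Listₚ.map-cong-local (All.tabulate (λ z∈ → first-choice (≢t z∈))))

-- Parity and the cut of the line

odd-+ : ∀ m n → odd (m + n) ≡ odd m xor odd n
odd-+ zero    n = refl
odd-+ (suc m) n = trans (cong not (odd-+ m n)) (not-distribˡ-xor (odd m) (odd n))

odd-double : ∀ n → odd (2 * n) ≡ false
odd-double n = trans (odd-+ n (n + 0))
  (trans (cong (odd n xor_) (cong odd (ℕₚ.+-identityʳ n))) (xor-same (odd n)))

module Halves {P : Set} (up : P → Bool) where
  open Counting up

  ups-++ : ∀ xs ys → ups (xs ++ ys) ≡ ups xs + ups ys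
  ups-++ []       ys = refl
  ups-++ (x ∷ xs) ys with up x
  ... | true  = cong suc (ups-++ xs ys)
  ... | false = ups-++ xs ys

  downs-++ : ∀ xs ys → downs (xs ++ ys) ≡ downs xs + downs ys
  downs-++ []       ys = refl
  downs-++ (x ∷ xs) ys with up x
  ... | true  = downs-++ xs ys
  ... | false = cong suc (downs-++ xs ys)

  ups-reverse : ∀ xs → ups (reverse xs) ≡ ups xs
  ups-reverse []       = refl
  ups-reverse (x ∷ xs) = trans (cong ups (Listₚ.unfold-reverse x xs)) (trans (ups-++ (reverse xs) (x ∷ []))
    (trans (ℕₚ.+-comm (ups (reverse xs)) _)
      (trans (cong (ups (x ∷ []) +_) (ups-reverse xs)) (sym (ups-++ (x ∷ []) xs)))))

  downs-reverse : ∀ xs → downs (reverse xs) ≡ downs xs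
  downs-reverse []       = refl
  downs-reverse (x ∷ xs) = trans (cong downs (Listₚ.unfold-reverse x xs)) (trans (downs-++ (reverse xs) (x ∷ []))
    (trans (ℕₚ.+-comm (downs (reverse xs)) _)
      (trans (cong (downs (x ∷ []) +_) (downs-reverse xs)) (sym (downs-++ (x ∷ []) xs)))))

  ups+downs : ∀ xs → ups xs + downs xs ≡ length xs
  ups+downs []       = refl
  ups+downs (x ∷ xs) with up x
  ... | true  = cong suc (ups+downs xs)
  ... | false = trans (ℕₚ.+-suc (ups xs) (downs xs)) (cong suc (ups+downs xs))

  trues-map : ∀ xs → trues (map up xs) ≡ ups xs
  trues-map []       = refl
  trues-map (x ∷ xs) with up x
  ... | true  = cong suc (trues-map xs)
  ... | false = trues-map xs

  lastUp-map : ∀ d xs → lastOr d (map up xs) ≡ lastUp d xs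
  lastUp-map d []       = refl
  lastUp-map d (x ∷ xs) = lastUp-map (up x) xs

  lastUp-∷ʳ : ∀ d xs x → lastUp d (xs ++ x ∷ []) ≡ up x
  lastUp-∷ʳ d []       x = refl
  lastUp-∷ʳ d (y ∷ xs) x = lastUp-∷ʳ (up y) xs x

  lastUp-reverse : ∀ d xs → lastUp d (reverse xs) ≡ headOr d (map up xs)
  lastUp-reverse d []       = refl
  lastUp-reverse d (x ∷ xs) = trans (cong (lastUp d) (Listₚ.unfold-reverse x xs)) (lastUp-∷ʳ d (reverse xs) x)

  module _ (L : List P) where

    X Y : List P
    X = take (ups L) L
    Y = reverse (drop (ups L) L)

    ups-halves : ups X + ups Y ≡ ups L
    ups-halves = trans (cong (ups X +_) (ups-reverse (drop (ups L) L)))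
      (trans (sym (ups-++ X (drop (ups L) L))) (cong ups (Listₚ.take++drop≡id (ups L) L)))

    downs-halves : downs X + downs Y ≡ downs L
    downs-halves = trans (cong (downs X +_) (downs-reverse (drop (ups L) L)))
      (trans (sym (downs-++ X (drop (ups L) L))) (cong downs (Listₚ.take++drop≡id (ups L) L)))

    length-X : length X ≡ ups L
    length-X = trans (Listₚ.length-take (ups L) L)
      (ℕₚ.m≤n⇒m⊓n≡m (ℕₚ.≤-trans (ℕₚ.m≤m+n (ups L) (downs L)) (ℕₚ.≤-reflexive (ups+downs L))))

    -- X has as many people as there are ups altogether.
    balanced : downs X ≡ ups Y
    balanced = ℕₚ.+-cancelˡ-≡ (ups X) _ _ (trans (ups+downs X) (trans length-X (sym ups-halves)))

    -- `ups L + downs L` is even. When both terms are split at the cut and `downs X` is replaced by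
    -- `ups Y`, the ups of `Y` occur twice and cancel.
    same-parity : odd (length L) ≡ false → odd (ups X) ≡ odd (downs Y)
    same-parity even = cancel (odd (ups X)) (odd (ups Y)) (odd (downs Y)) (begin
      (odd (ups X) xor odd (ups Y)) xor (odd (ups Y) xor odd (downs Y))
        ≡⟨ cong₂ _xor_ (odd-+ (ups X) (ups Y)) (odd-+ (ups Y) (downs Y)) ⟨
      odd (ups X + ups Y) xor odd (ups Y + downs Y)
        ≡⟨ cong₂ (λ p q → odd p xor odd q) ups-halves (trans (cong (_+ downs Y) (sym balanced)) downs-halves) ⟩
      odd (ups L) xor odd (downs L)
        ≡⟨ odd-+ (ups L) (downs L) ⟨
      odd (ups L + downs L)
        ≡⟨ trans (cong odd (ups+downs L)) even ⟩
      false ∎)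
      where
      open ≡-Reasoning
      cancel : ∀ a b c → (a xor b) xor (b xor c) ≡ false → a ≡ c
      cancel false false false _ = refl
      cancel false true  false _ = refl
      cancel true  false true  _ = refl
      cancel true  true  true  _ = refl

    two-halves : twoBits (map up L) ≡ two X Y
    two-halves rewrite trues-map L | Listₚ.take-map {f = up} (ups L) L | Listₚ.drop-map {f = up} (ups L) L
      | trues-map X | lastUp-map true X | lastUp-reverse false (drop (ups L) L) = refl

across-take-drop : ∀ {A : Set} {R : A → A → Set} k {xs} → AllPairs R xs →
                   All (λ x → All (R x) (drop k xs)) (take k xs)
across-take-drop zero    _        = []
across-take-drop (suc k) []       = []
across-take-drop (suc k) (r ∷ rs) = Allₚ.drop⁺ k r ∷ across-take-drop k rs

-- The number of stable assignments in terms of the table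

module _ {n : ℕ} (I : Roommates n) (ps : Positions I) where
  open Positions ps

  -- The lists compare distinct people only. This relation covers all triples, as `rival` requires,
  -- where `p` ranks `t` above everybody in a list that contains `p`.
  Pref : Person n → Person n → Person n → Set
  Pref x y z = (up x ≡ true × y ≺ z) ⊎ (up x ≡ false × z ≺ y)

  Pref-asym : ∀ {x y z} → Pref x y z → ¬ Pref x z y
  Pref-asym (inj₁ (_ , p)) (inj₁ (_ , q)) = ≺-irrefl (≺-trans p q)
  Pref-asym (inj₁ (u , _)) (inj₂ (v , _)) = case trans (sym u) v of λ ()
  Pref-asym (inj₂ (u , _)) (inj₁ (v , _)) = case trans (sym u) v of λ ()
  Pref-asym (inj₂ (_ , p)) (inj₂ (_ , q)) = ≺-irrefl (≺-trans p q)

  prefers⇒ : ∀ {x y z} → Prefers I x y z → Pref x y z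
  prefers⇒ {x} p with up x in u
  ... | true  = inj₁ (refl , prefers-up u p)
  ... | false = inj₂ (refl , prefers-down u p)

  prefers⇔ : ∀ {x y z} → x ≢ y → x ≢ z → y ≢ z → Prefers I x y z ⇔ Pref x y z
  prefers⇔ {x} {y} {z} x≢y x≢z y≢z = mk⇔ prefers⇒ back
    where
    back : Pref x y z → Prefers I x y z
    back p with pair-⊆-total (∈-prefs I (≢-sym x≢y)) (∈-prefs I (≢-sym x≢z)) y≢z
    ... | inj₁ q = q
    ... | inj₂ q = ⊥-elim (Pref-asym p (prefers⇒ q))

  open Lines _≟_ Pref Pref-asym

  line : Line
  line = record
    { up        = up
    ; _≺_       = _≺_
    ; irrefl    = λ { lt refl → ≺-irrefl lt }
    ; pref-up   = λ u lt → inj₁ (u , lt)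
    ; pref-down = λ u lt → inj₂ (u , lt) }

  open Halves up hiding (X; Y)

  count-lineup : ∀ {L} → AllPairs _≺_ L → (∀ x → x ∈ L) →
                 countStable I ≡ (ifᵇ twoBits (map up L) then 2 else 1)
  count-lineup {L} sorted everyone = count I Pref Pref-asym prefers⇔ everyone′ _
    (subst (λ b → Solutions b (X ++ Y)) (sym (two-halves L))
      (Solve.solve line X Y
        (Line.split (AllPairsₚ.take⁺ (ups L) sorted) (reverse-sorted (AllPairsₚ.drop⁺ (ups L) sorted))
          (All.map (λ lts → All.tabulate (λ y∈ → All.lookup lts (reverse⁻ y∈))) (across-take-drop (ups L) sorted)))
        (balanced L) (same-parity L even)))
    where
    open Counting up using (ups)
    X Y : List (Person n)
    X = take (ups L) L
    Y = reverse (drop (ups L) L)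
    everyone′ : ∀ x → x ∈ X ++ Y
    everyone′ x with ∈-++⁻ X (subst (x ∈_) (sym (Listₚ.take++drop≡id (ups L) L)) (everyone x))
    ... | inj₁ x∈ = ∈-++⁺ˡ x∈
    ... | inj₂ x∈ = ∈-++⁺ʳ X (reverse⁺ x∈)
    even : odd (length L) ≡ false
    even = trans (cong odd (trans
      (↭-length (same-members (AllPairs.map (λ { lt refl → ≺-irrefl lt }) sorted) (Uniqueₚ.allFin⁺ _)
        (λ {z} → mk⇔ (λ _ → ∈-allFin z) (λ _ → everyone z))))
      (Listₚ.length-tabulate {n = 2 * n} (λ y → y)))) (odd-double n)

nonempty : ∀ {A : Set} {l : List A} → 1 ≤ length l → ∃[ x ] ∃[ r ] l ≡ x ∷ r
nonempty {l = x ∷ r} _ = x , r , refl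

at-least-three : ∀ {A : Set} {l : List A} → 3 ≤ length l → ∃[ x ] ∃[ y ] ∃[ z ] ∃[ r ] l ≡ x ∷ y ∷ z ∷ r
at-least-three {l = x ∷ []}          (s≤s ())
at-least-three {l = x ∷ y ∷ []}      (s≤s (s≤s ()))
at-least-three {l = x ∷ y ∷ z ∷ r} _ = x , y , z , r , refl

module _ {n : ℕ} (I : Roommates n) (long : ∀ x → 3 ≤ length (prefs I x)) {o : Person n} (o≡0 : toℕ o ≡ 0) where

  count-oriented : (ps : Positions I) → ∀ {a i c l₀} → prefs I o ≡ a ∷ i ∷ c ∷ l₀ → Positions.up ps i ≡ true →
                   countStable I ≡ (ifᵇ answer (table I) then 2 else 1)
  count-oriented ps {i = i} eq₀ up-i =
    let t , _ , eqᵢ = nonempty (ℕₚ.≤-trans (s≤s z≤n) (long i))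
        _ , _ , eqₜ = nonempty (ℕₚ.≤-trans (s≤s z≤n) (long t))
    in trans (count-lineup I ps (lineup-sorted I ps o≡0 eq₀ eqᵢ eqₜ up-i) (∈-lineup I ps o≡0 eq₀ eqᵢ eqₜ up-i))
             (cong (λ w → ifᵇ twoBits w then 2 else 1) (sym (word-lineup I ps o≡0 eq₀ eqᵢ eqₜ up-i)))

  count-positions : Positions I → countStable I ≡ (ifᵇ answer (table I) then 2 else 1)
  count-positions ps with at-least-three (long o)
  ... | _ , i , _ , _ , eq₀ = orientation (Positions.up ps i) refl
    where
    orientation : ∀ b → Positions.up ps i ≡ b → countStable I ≡ (ifᵇ answer (table I) then 2 else 1)
    orientation true  up-i = count-oriented ps eq₀ up-i
    -- A down `i` becomes an up in the turned line, and `answer` depends on the table alone, which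
    -- stays the same.
    orientation false up-i = count-oriented (turned I ps) eq₀ (cong not up-i)

-- Lists of one entry reveal no signs, so there are no `Positions` to work with. As no three people
-- are distinct, the empty relation serves as `Pref`; the table is the only possible one, and
-- `answer` evaluates to `false` on it.
count-couple : (I : Roommates 1) → countStable I ≡ (ifᵇ answer (table I) then 2 else 1)
count-couple I = trans
  (count I (λ _ _ _ → ⊥) (λ ()) (λ {x} {y} {z} x≢y x≢z y≢z → ⊥-elim (no-third x y z x≢y x≢z y≢z))
    {L = allFin 2} ∈-allFin false (Matchings.two-people _≟_ _ (λ ()) (λ ())))
  (cong (λ tab → ifᵇ answer tab then 2 else 1) (sym table-couple))
  where
  no-third : ∀ (x y z : Fin 2) → x ≢ y → x ≢ z → y ≢ z → ⊥
  no-third zero       zero       _          p _ _ = p refl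
  no-third zero       (suc zero) zero       _ p _ = p refl
  no-third zero       (suc zero) (suc zero) _ _ p = p refl
  no-third (suc zero) (suc zero) _          p _ _ = p refl
  no-third (suc zero) zero       (suc zero) _ p _ = p refl
  no-third (suc zero) zero       zero       _ _ p = p refl
  singleton : ∀ {l : List (Person 1)} → length l ≡ 1 → ∀ {y} → y ∈ l → l ≡ y ∷ []
  singleton {_ ∷ []} _ (here refl) = refl
  only : ∀ x y → y ≢ x → prefs I x ≡ y ∷ []
  only x y y≢x = singleton (ℕₚ.suc-injective (length-prefs I x)) (∈-prefs I y≢x)
  table-couple : table I ≡ (1 ∷ []) ∷ (0 ∷ []) ∷ []
  table-couple = cong₂ (λ l m → map toℕ l ∷ map toℕ m ∷ [])
    (only zero (suc zero) (λ ())) (only (suc zero) zero (λ ()))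

count-answer : ∀ {n} (I : Roommates n) → 1 ≤ n → OneAttributeModel I →
               countStable I ≡ (ifᵇ answer (table I) then 2 else 1)
count-answer {suc zero}    I _ _     = count-couple I
count-answer {suc (suc n)} I _ model = count-positions I long {o = zero} refl
  (positions I model (λ x → ℕₚ.≤-trans (s≤s (s≤s z≤n)) (long x)))
  where
  long : ∀ x → 3 ≤ length (prefs I x)
  long x = ℕₚ.≤-pred (ℕₚ.≤-trans (ℕₚ.*-monoʳ-≤ 2 (s≤s (s≤s (z≤n {n})))) (ℕₚ.≤-reflexive (sym (length-prefs I x))))

-- Polynomial-time programs

infixl 5 _⟫_

-- A language of total functions on trees.  The only loop, `repeat`, runs as often as the clock is long, so that
-- running times are polynomial in the clock.
data Fun : Set where
  self empty left right : Fun
  _⟫_ pair              : Fun → Fun → Fun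
  branch                : Fun → Fun → Fun → Fun
  repeat                : Fun → Fun

choose : Tree → Tree → Tree → Tree
choose nil     s t = t
choose (_ ∙ _) s t = s

iterate : ℕ → (Tree → Tree) → Tree → Tree
iterate zero    f s = s
iterate (suc n) f s = iterate n f (f s)

⟦_⟧ : Fun → ℕ → Tree → Tree
⟦ self ⟧         N s = s
⟦ empty ⟧        N s = nil
⟦ left ⟧         N s = head s
⟦ right ⟧        N s = tail s
⟦ f ⟫ g ⟧        N s = ⟦ g ⟧ N (⟦ f ⟧ N s)
⟦ pair f g ⟧     N s = ⟦ f ⟧ N s ∙ ⟦ g ⟧ N s
⟦ branch f g h ⟧ N s = choose (⟦ f ⟧ N s) (⟦ g ⟧ N s) (⟦ h ⟧ N s)
⟦ repeat f ⟧     N s = iterate N (⟦ f ⟧ N) s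

-- Compilation to WHILE

weakenExpr : ∀ {k} → Expr k → Expr (suc k)
weakenExpr (var i)    = var (suc i)
weakenExpr nil        = nil
weakenExpr (cons e f) = cons (weakenExpr e) (weakenExpr f)
weakenExpr (hd e)     = hd (weakenExpr e)
weakenExpr (tl e)     = tl (weakenExpr e)

-- Acts as a frame rule: the new variable 0 is neither read nor written, so a subprogram can run on
-- a later part of the store.
weaken : ∀ {k} → Command k → Command (suc k)
weaken (i ≔ e)                = suc i ≔ weakenExpr e
weaken (p ⨾ q)                = weaken p ⨾ weaken q
weaken (if e then p else q)   = if weakenExpr e then weaken p else weaken q
weaken (while e run p)        = while weakenExpr e run weaken p

eval-weaken : ∀ {k} (e : Expr k) {s σ} → eval (weakenExpr e) (s ∷ σ) ≡ eval e σ
eval-weaken (var i)    = refl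
eval-weaken nil        = refl
eval-weaken (cons e f) = cong₂ _∙_ (eval-weaken e) (eval-weaken f)
eval-weaken (hd e)     = cong head (eval-weaken e)
eval-weaken (tl e)     = cong tail (eval-weaken e)

cost-weaken : ∀ {k} (e : Expr k) → cost (weakenExpr e) ≡ cost e
cost-weaken (var i)    = refl
cost-weaken nil        = refl
cost-weaken (cons e f) = cong suc (cong₂ _+_ (cost-weaken e) (cost-weaken f))
cost-weaken (hd e)     = cong suc (cost-weaken e)
cost-weaken (tl e)     = cong suc (cost-weaken e)

run-weaken : ∀ {k} {p : Command k} {s σ τ t} → ⟨ p , σ ⟩⇓⟨ τ , t ⟩ → ⟨ weaken p , s ∷ σ ⟩⇓⟨ s ∷ τ , t ⟩
run-weaken {s = s} (assign {i} {e} {σ}) =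
  subst₂ (λ u t → ⟨ suc i ≔ weakenExpr e , s ∷ σ ⟩⇓⟨ s ∷ (σ [ i ]≔ u) , suc t ⟩)
    (eval-weaken e) (cost-weaken e) assign
run-weaken (compose p q) = compose (run-weaken p) (run-weaken q)
run-weaken (if-true {e} ≢ p) rewrite sym (cost-weaken e) =
  if-true (λ eq → ≢ (trans (sym (eval-weaken e)) eq)) (run-weaken p)
run-weaken (if-false {e} eq q) rewrite sym (cost-weaken e) =
  if-false (trans (eval-weaken e) eq) (run-weaken q)
run-weaken (while-true {e} ≢ p q) rewrite sym (cost-weaken e) =
  while-true (λ eq → ≢ (trans (sym (eval-weaken e)) eq)) (run-weaken p) (run-weaken q)
run-weaken (while-false {e} eq) rewrite sym (cost-weaken e) =
  while-false (trans (eval-weaken e) eq)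

infix 4 ⟨_,_⟩⇒⟨_,_⟩

⟨_,_⟩⇒⟨_,_⟩ : ∀ {k} → Command k → Store k → Store k → ℕ → Set
⟨ p , σ ⟩⇒⟨ τ , b ⟩ = ∃[ t ] ⟨ p , σ ⟩⇓⟨ τ , t ⟩ × t ≤ b

infixr 6 _►_

_►_ : ∀ {k} {p q : Command k} {σ τ υ a b} →
         ⟨ p , σ ⟩⇒⟨ τ , a ⟩ → ⟨ q , τ ⟩⇒⟨ υ , b ⟩ → ⟨ p ⨾ q , σ ⟩⇒⟨ υ , a + b ⟩
(_ , p , s≤) ► (_ , q , t≤) = _ , compose p q , ℕₚ.+-mono-≤ s≤ t≤

assigned : ∀ {k} {i : Fin k} {e σ} → ⟨ i ≔ e , σ ⟩⇒⟨ σ [ i ]≔ eval e σ , suc (cost e) ⟩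
assigned = _ , assign , ℕₚ.≤-refl

weakened : ∀ {k} {p : Command k} {s σ τ b} → ⟨ p , σ ⟩⇒⟨ τ , b ⟩ → ⟨ weaken p , s ∷ σ ⟩⇒⟨ s ∷ τ , b ⟩
weakened (_ , p , t≤) = _ , run-weaken p , t≤

space : Fun → ℕ
space (f ⟫ g)        = space f ⊔ space g
space (pair f g)     = 4 + (space f ⊔ space g)
space (branch f g h) = 2 + (space f ⊔ (space g ⊔ space h))
space (repeat f)     = 2 + space f
space _              = 0

pattern #0 = zero
pattern #1 = suc zero
pattern #2 = suc #1
pattern #3 = suc #2
pattern #4 = suc #3
pattern #5 = suc #4

left-≤ : ∀ {m n k} → m ⊔ n ≤ k → m ≤ k
left-≤ {m} {n} = ℕₚ.≤-trans (ℕₚ.m≤m⊔n m n)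

right-≤ : ∀ {m n k} → m ⊔ n ≤ k → n ≤ k
right-≤ {m} {n} = ℕₚ.≤-trans (ℕₚ.m≤n⊔m m n)

wider : ∀ {m k} → m ≤ k → m ≤ 2 + k
wider le = ℕₚ.m≤n⇒m≤1+n (ℕₚ.m≤n⇒m≤1+n le)

-- Variable 0 holds argument and result, variable 1 the clock, and the others are scratch space.
compile : ∀ f k → space f ≤ k → Command (2 + k)
compile self    k _ = #0 ≔ var #0
compile empty   k _ = #0 ≔ nil
compile left    k _ = #0 ≔ hd (var #0)
compile right   k _ = #0 ≔ tl (var #0)
compile (f ⟫ g) k le = compile f k (left-≤ le) ⨾ compile g k (right-≤ {space f} le)
compile (pair f g) (suc (suc (suc (suc k)))) (s≤s (s≤s (s≤s (s≤s le)))) =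
  -- `f` works on copies of argument and clock in variables 2 and 3, with all later ones as scratch
  -- space. `g` then takes 4 and 5, which overwrites that space but not the result in 2.
  #2 ≔ var #0 ⨾ #3 ≔ var #1 ⨾ weaken (weaken (compile f (2 + k) (wider (left-≤ le)))) ⨾
  #4 ≔ var #0 ⨾ #5 ≔ var #1 ⨾ weaken (weaken (weaken (weaken (compile g k (right-≤ {space f} le))))) ⨾
  #0 ≔ cons (var #2) (var #4)
compile (branch f g h) (suc (suc k)) (s≤s (s≤s le)) =
  -- The test runs on copies, so that argument and clock are still in place for the chosen branch.
  #2 ≔ var #0 ⨾ #3 ≔ var #1 ⨾ weaken (weaken (compile f k (left-≤ le))) ⨾
  (if var #2 then compile g (2 + k) (wider (left-≤ (right-≤ {space f} le)))
   else compile h (2 + k) (wider (right-≤ {space g} (right-≤ {space f} le))))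
compile (repeat f) (suc (suc k)) (s≤s (s≤s le)) =
  -- Variable 2 carries the state, and 3 the clock for the body; the copy of the clock in variable 0
  -- is used up as the loop counter.
  #2 ≔ var #0 ⨾ #3 ≔ var #1 ⨾ #0 ≔ var #1 ⨾
  (while var #0 run (weaken (weaken (compile f k le)) ⨾ #0 ≔ tl (var #0))) ⨾
  #0 ≔ var #2

-- The nesting follows the sequences in `compile`, so that `_►_` yields these bounds as they stand.
-- A branch is charged for both alternatives, so that only sums and products with `N` arise.
bound : Fun → ℕ → ℕ
bound self           N = 2
bound empty          N = 2
bound left           N = 3
bound right          N = 3
bound (f ⟫ g)        N = bound f N + bound g N
bound (pair f g)     N = 2 + (2 + (bound f N + (2 + (2 + (bound g N + 4)))))
bound (branch f g h) N = 2 + (2 + (bound f N + (2 + (bound g N + bound h N))))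
bound (repeat f)     N = 2 + (2 + (2 + ((N * (2 + (bound f N + 3)) + 2) + 2)))

spine : Tree → ℕ
spine nil     = 0
spine (s ∙ t) = suc (spine t)

-- Scratch contents are arbitrary at the start and unspecified at the end, so that programs can be
-- composed and loop bodies repeated without clearing them; the clock survives.
compile-correct : ∀ f k (le : space f ≤ k) s c (σ : Vec Tree k) →
  ∃[ τ ] ⟨ compile f k le , s ∷ c ∷ σ ⟩⇒⟨ ⟦ f ⟧ (spine c) s ∷ c ∷ τ , bound f (spine c) ⟩
compile-correct self  k _ s c σ = σ , assigned
compile-correct empty k _ s c σ = σ , assigned
compile-correct left  k _ s c σ = σ , assigned
compile-correct right k _ s c σ = σ , assigned
compile-correct (f ⟫ g) k le s c σ =
  let σ₁ , p = compile-correct f k (left-≤ le) s c σ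
      σ₂ , q = compile-correct g k (right-≤ {space f} le) _ c σ₁
  in σ₂ , p ► q
compile-correct (pair f g) (suc (suc (suc (suc k)))) (s≤s (s≤s (s≤s (s≤s le)))) s c (_ ∷ _ ∷ u ∷ v ∷ σ)
  with compile-correct f (2 + k) (wider (left-≤ le)) s c (u ∷ v ∷ σ)
... | _ ∷ _ ∷ σ₁ , p =
  let σ₂ , q = compile-correct g k (right-≤ {space f} le) s c σ₁
  in _ , assigned ► assigned ► weakened (weakened p) ►
         assigned ► assigned ► weakened (weakened (weakened (weakened q))) ► assigned
compile-correct (branch f g h) (suc (suc k)) (s≤s (s≤s le)) s c (_ ∷ _ ∷ σ) =
  let σ₁ , p = compile-correct f k (left-≤ le) s c σ
      τ , q = test (⟦ f ⟧ (spine c) s) (c ∷ σ₁)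
  in τ , assigned ► assigned ► weakened (weakened p) ► q
  where
  G = compile g (2 + k) (wider (left-≤ (right-≤ {space f} le)))
  H = compile h (2 + k) (wider (right-≤ {space g} (right-≤ {space f} le)))
  test : ∀ b σ → ∃[ τ ] ⟨ if var #2 then G else H , s ∷ c ∷ b ∷ σ ⟩⇒⟨
           choose b (⟦ g ⟧ (spine c) s) (⟦ h ⟧ (spine c) s) ∷ c ∷ τ , 2 + (bound g (spine c) + bound h (spine c)) ⟩
  test nil σ =
    let τ , _ , q , t≤ = compile-correct h (2 + k) _ s c (nil ∷ σ)
    in τ , _ , if-false refl q , ℕₚ.+-monoʳ-≤ 2 (ℕₚ.≤-trans t≤ (ℕₚ.m≤n+m _ (bound g (spine c))))
  test (a ∙ b) σ =
    let τ , _ , q , t≤ = compile-correct g (2 + k) _ s c ((a ∙ b) ∷ σ)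
    in τ , _ , if-true (λ ()) q , ℕₚ.+-monoʳ-≤ 2 (ℕₚ.≤-trans t≤ (ℕₚ.m≤m+n _ (bound h (spine c))))
compile-correct (repeat f) (suc (suc k)) (s≤s (s≤s le)) s c (_ ∷ _ ∷ σ) =
  let τ , p = loop c s σ
  in _ , assigned ► assigned ► assigned ► p ► assigned
  where
  body = weaken (weaken (compile f k le)) ⨾ #0 ≔ tl (var #0)
  loop : ∀ d s σ → ∃[ τ ] ⟨ while var #0 run body , d ∷ c ∷ s ∷ c ∷ σ ⟩⇒⟨
           nil ∷ c ∷ iterate (spine d) (⟦ f ⟧ (spine c)) s ∷ c ∷ τ , spine d * (2 + (bound f (spine c) + 3)) + 2 ⟩
  loop nil s σ = σ , _ , while-false refl , ℕₚ.≤-refl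
  loop (a ∙ d) s σ =
    let σ₁ , p          = compile-correct f k le s c σ
        _ , q , t≤      = weakened (weakened p) ► assigned
        τ , _ , r , t≤′ = loop d _ σ₁
    in τ , _ , while-true (λ ()) q r ,
       ℕₚ.≤-trans (ℕₚ.+-monoʳ-≤ 2 (ℕₚ.+-mono-≤ t≤ t≤′))
         (ℕₚ.≤-reflexive (sym (ℕₚ.+-assoc (2 + (bound f (spine c) + 3)) (spine d * (2 + (bound f (spine c) + 3))) 2)))

-- Polynomial bounds

Polynomial : (ℕ → ℕ) → Set
Polynomial g = ∃[ c ] ∃[ d ] ∀ N → g N ≤ c * suc N ^ d

polynomial-const : ∀ k → Polynomial (λ _ → k)
polynomial-const k = k , 0 , λ _ → ℕₚ.≤-reflexive (sym (ℕₚ.*-identityʳ k))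

-- The sum of the exponents serves both terms: the base `suc N` is positive, so a larger exponent
-- never lowers the power.
polynomial-+ : ∀ {g h} → Polynomial g → Polynomial h → Polynomial (λ N → g N + h N)
polynomial-+ {g} {h} (c , d , g≤) (c′ , d′ , h≤) = c + c′ , d + d′ , λ N → begin
  g N + h N                                           ≤⟨ ℕₚ.+-mono-≤ (g≤ N) (h≤ N) ⟩
  c * suc N ^ d + c′ * suc N ^ d′                     ≤⟨ ℕₚ.+-mono-≤
                                                           (ℕₚ.*-monoʳ-≤ c (ℕₚ.^-monoʳ-≤ (suc N) (ℕₚ.m≤m+n d d′)))
                                                           (ℕₚ.*-monoʳ-≤ c′ (ℕₚ.^-monoʳ-≤ (suc N) (ℕₚ.m≤n+m d′ d))) ⟩
  c * suc N ^ (d + d′) + c′ * suc N ^ (d + d′)        ≡⟨ ℕₚ.*-distribʳ-+ (suc N ^ (d + d′)) c c′ ⟨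
  (c + c′) * suc N ^ (d + d′)                         ∎
  where open ℕₚ.≤-Reasoning

polynomial-N* : ∀ {g} → Polynomial g → Polynomial (λ N → N * g N)
polynomial-N* {g} (c , d , g≤) = c , suc d , λ N → begin
  N * g N                  ≤⟨ ℕₚ.*-mono-≤ (ℕₚ.n≤1+n N) (g≤ N) ⟩
  suc N * (c * suc N ^ d)  ≡⟨ ℕₚ.*-assoc (suc N) c _ ⟨
  suc N * c * suc N ^ d    ≡⟨ cong (_* suc N ^ d) (ℕₚ.*-comm (suc N) c) ⟩
  c * suc N * suc N ^ d    ≡⟨ ℕₚ.*-assoc c (suc N) _ ⟩
  c * suc N ^ suc d        ∎
  where open ℕₚ.≤-Reasoning

polynomial-bound : ∀ f → Polynomial (bound f)
polynomial-bound self    = polynomial-const 2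
polynomial-bound empty   = polynomial-const 2
polynomial-bound left    = polynomial-const 3
polynomial-bound right   = polynomial-const 3
polynomial-bound (f ⟫ g) = polynomial-+ (polynomial-bound f) (polynomial-bound g)
polynomial-bound (pair f g) =
  polynomial-+ (polynomial-const 4) (polynomial-+ (polynomial-bound f)
    (polynomial-+ (polynomial-const 4) (polynomial-+ (polynomial-bound g) (polynomial-const 4))))
polynomial-bound (branch f g h) =
  polynomial-+ (polynomial-const 4) (polynomial-+ (polynomial-bound f)
    (polynomial-+ (polynomial-const 2) (polynomial-+ (polynomial-bound g) (polynomial-bound h))))
polynomial-bound (repeat f) =
  polynomial-+ (polynomial-const 6) (polynomial-+ (polynomial-+ (polynomial-N*
    (polynomial-+ (polynomial-const 2) (polynomial-+ (polynomial-bound f) (polynomial-const 3))))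
    (polynomial-const 2)) (polynomial-const 2))

spine-size : ∀ s → suc (spine s) ≤ size s
spine-size nil     = s≤s z≤n
spine-size (s ∙ t) = s≤s (ℕₚ.≤-trans (spine-size t) (ℕₚ.m≤n+m (size t) (size s)))

-- The clock is the input itself, as a list.
polynomialTime : ∀ {A : Set} (encode : A → Tree) {f : A → ℕ} p →
                 (∀ a → ⟦ p ⟧ (spine (encode a)) (encode a) ≡ encodeℕ (f a)) → PolynomialTime encode f
polynomialTime encode {f} p computes with polynomial-bound p
-- Copying the input to the clock takes 2 steps; as `size s ^ d` is at least 1, adding 2 to the
-- coefficient pays for them.
... | c , d , bound≤ = suc (space p) , (#1 ≔ var #0 ⨾ compile p (space p) ℕₚ.≤-refl) , 2 + c , d , λ a →
  let s                = encode a
      τ , t , ran , t≤ = compile-correct p (space p) ℕₚ.≤-refl s s (Vec.replicate _ nil)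
  in _ , _ , compose assign ran , computes a , (begin
    2 + t                                     ≤⟨ ℕₚ.+-mono-≤ (ℕₚ.*-monoʳ-≤ 2 (ℕₚ.m^n>0 (size s) {{size-nonZero s}} d))
                                                            (ℕₚ.≤-trans t≤ (bound≤ (spine s))) ⟩
    2 * size s ^ d + c * suc (spine s) ^ d    ≤⟨ ℕₚ.+-monoʳ-≤ (2 * size s ^ d)
                                                   (ℕₚ.*-monoʳ-≤ c (ℕₚ.^-monoˡ-≤ d (spine-size s))) ⟩
    2 * size s ^ d + c * size s ^ d           ≡⟨ ℕₚ.*-distribʳ-+ (size s ^ d) 2 c ⟨
    (2 + c) * size s ^ d                      ∎)
  where
  open ℕₚ.≤-Reasoning
  size-nonZero : ∀ s → NonZero (size s)
  size-nonZero nil     = _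
  size-nonZero (_ ∙ _) = _

-- The criterion as a program

encodeBool : Bool → Tree
encodeBool true  = nil ∙ nil
encodeBool false = nil

encodeRow : List ℕ → Tree
encodeRow r = encodeList (map encodeℕ r)

encodeTable : List (List ℕ) → Tree
encodeTable rows = encodeList (map encodeRow rows)

encodeBits : List Bool → Tree
encodeBits bs = encodeList (map encodeBool bs)

-- Once the list is exhausted, the state stays as it is, so the clock may be longer than the list.
foldStep : Fun → Fun
foldStep f = branch left (pair (left ⟫ right) (pair (right ⟫ left) (pair (left ⟫ left) right ⟫ f))) self

-- Folds over the list of list ∙ (environment ∙ accumulator); f receives item ∙ (environment ∙ accumulator).
fold : Fun → Fun
fold f = repeat (foldStep f) ⟫ right ⟫ right

fold-correct : ∀ f {N} ts e a → length ts ≤ N →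
               ⟦ fold f ⟧ N (encodeList ts ∙ (e ∙ a)) ≡ foldl (λ b t → ⟦ f ⟧ N (t ∙ (e ∙ b))) a ts
fold-correct f {N} ts e a le = cong (tail ∘ tail) (go N ts a le)
  where
  go : ∀ k ts a → length ts ≤ k → iterate k (⟦ foldStep f ⟧ N) (encodeList ts ∙ (e ∙ a)) ≡
       nil ∙ (e ∙ foldl (λ b t → ⟦ f ⟧ N (t ∙ (e ∙ b))) a ts)
  go zero    []       a _        = refl
  go (suc k) []       a _        = go k [] a z≤n
  go (suc k) (t ∷ ts) a (s≤s le) = go k ts _ le

encodeℕ-list : ∀ n → encodeℕ n ≡ encodeList (replicate n nil)
encodeℕ-list zero    = refl
encodeℕ-list (suc n) = cong (nil ∙_) (encodeℕ-list n)

times : Fun → Fun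
times f = fold (right ⟫ right ⟫ f)

times-correct : ∀ f {N} n e a → n ≤ N → ⟦ times f ⟧ N (encodeℕ n ∙ (e ∙ a)) ≡ iterate n (⟦ f ⟧ N) a
times-correct f {N} n e a le = begin
  ⟦ times f ⟧ N (encodeℕ n ∙ (e ∙ a))
    ≡⟨ cong (λ s → ⟦ times f ⟧ N (s ∙ (e ∙ a))) (encodeℕ-list n) ⟩
  ⟦ times f ⟧ N (encodeList (replicate n nil) ∙ (e ∙ a))
    ≡⟨ fold-correct (right ⟫ right ⟫ f) (replicate n nil) e a (subst (_≤ N) (sym (Listₚ.length-replicate n)) le) ⟩
  foldl (λ b _ → ⟦ f ⟧ N b) a (replicate n nil)
    ≡⟨ go n a ⟩
  iterate n (⟦ f ⟧ N) a ∎
  where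
  open ≡-Reasoning
  go : ∀ n a → foldl (λ b _ → ⟦ f ⟧ N b) a (replicate n nil) ≡ iterate n (⟦ f ⟧ N) a
  go zero    a = refl
  go (suc n) a = go n _

lookupRow : Fun
lookupRow = pair right (pair empty left) ⟫ times right ⟫ left

lookupRow-correct : ∀ {N} rows i → i ≤ N → ⟦ lookupRow ⟧ N (encodeTable rows ∙ encodeℕ i) ≡ encodeRow (row rows i)
lookupRow-correct rows i le = trans (cong head (times-correct right i nil (encodeTable rows) le)) (go rows i)
  where
  go : ∀ rows i → head (iterate i tail (encodeTable rows)) ≡ encodeRow (row rows i)
  go []         zero    = refl
  go []         (suc i) = go [] i
  go (r ∷ rows) zero    = refl
  go (r ∷ rows) (suc i) = go rows i

first-correct : ∀ r → head (encodeRow r) ≡ encodeℕ (first r)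
first-correct []      = refl
first-correct (_ ∷ _) = refl

lastEntry : Fun
lastEntry = pair self (pair empty empty) ⟫ fold left

lastEntry-correct : ∀ {N} r → length r ≤ N → ⟦ lastEntry ⟧ N (encodeRow r) ≡ encodeℕ (lastOr 0 r)
lastEntry-correct r le = trans
  (fold-correct left (map encodeℕ r) nil nil (subst (_≤ _) (sym (Listₚ.length-map encodeℕ r)) le)) (go 0 r)
  where
  go : ∀ d r → foldl (λ _ t → t) (encodeℕ d) (map encodeℕ r) ≡ encodeℕ (lastOr d r)
  go d []      = refl
  go d (x ∷ r) = go x r

subtract : Fun
subtract = pair left (pair empty right) ⟫ times right

subtract-correct : ∀ {N} m n → m ≤ N → ⟦ subtract ⟧ N (encodeℕ m ∙ encodeℕ n) ≡ encodeℕ (n ∸ m)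
subtract-correct m n le = trans (times-correct right m nil (encodeℕ n) le) (go m n)
  where
  go : ∀ m n → iterate m tail (encodeℕ n) ≡ encodeℕ (n ∸ m)
  go zero    n       = refl
  go (suc m) zero    = trans (go m zero) (cong encodeℕ (ℕₚ.0∸n≡0 m))
  go (suc m) (suc n) = go m n

truth : Fun
truth = pair empty empty

-- Numbers are equal when both truncated differences vanish.
equal : Fun
equal = branch subtract empty (branch (pair right left ⟫ subtract) empty truth)

equal-correct : ∀ {N} m n → m ≤ N → n ≤ N → ⟦ equal ⟧ N (encodeℕ m ∙ encodeℕ n) ≡ encodeBool (m ≡ᵇ n)
equal-correct m n m≤N n≤N rewrite subtract-correct m n m≤N | subtract-correct n m n≤N = go m n
  where
  go : ∀ m n → choose (encodeℕ (n ∸ m)) nil (choose (encodeℕ (m ∸ n)) nil (nil ∙ nil)) ≡ encodeBool (m ≡ᵇ n)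
  go zero    zero    = refl
  go zero    (suc n) = refl
  go (suc m) zero    = refl
  go (suc m) (suc n) = go m n

consFirst reversal : Fun
consFirst = pair left (right ⟫ right)
reversal  = pair self (pair empty empty) ⟫ fold consFirst

foldl-cons : ∀ {A : Set} (h : A → Tree) bs xs →
             foldl (λ t x → h x ∙ t) (encodeList bs) xs ≡ encodeList (map h xs ʳ++ bs)
foldl-cons h bs []       = refl
foldl-cons h bs (x ∷ xs) = foldl-cons h (h x ∷ bs) xs

reversal-correct : ∀ {N} bs → length bs ≤ N → ⟦ reversal ⟧ N (encodeBits bs) ≡ encodeBits (reverse bs)
reversal-correct {N} bs le = begin
  foldOver (encodeBits bs)                         ≡⟨ fold-correct consFirst (map encodeBool bs) nil nil
                                                        (subst (_≤ _) (sym (Listₚ.length-map encodeBool bs)) le) ⟩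
  foldl (λ t b → b ∙ t) nil (map encodeBool bs)    ≡⟨ Listₚ.foldl-map (λ t b → b ∙ t) encodeBool nil bs ⟩
  foldl (λ t b → encodeBool b ∙ t) nil bs          ≡⟨ foldl-cons encodeBool [] bs ⟩
  encodeList (reverse (map encodeBool bs))         ≡⟨ cong encodeList (Listₚ.reverse-map encodeBool bs) ⟨
  encodeBits (reverse bs)                          ∎
  where
  open ≡-Reasoning
  foldOver : Tree → Tree
  foldOver s = ⟦ fold consFirst ⟧ N (s ∙ (nil ∙ nil))

-- On z ∙ ((table ∙ end) ∙ bits).
consBit : Fun
consBit = pair (pair (pair (right ⟫ left ⟫ left) left ⟫ lookupRow ⟫ left) (right ⟫ left ⟫ right) ⟫ equal)
               (right ⟫ right)

-- On (table ∙ end) ∙ list.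
reversedBits : Fun
reversedBits = pair right (pair left empty) ⟫ fold consBit

-- The clock has to outlast every loop: those over rows, those over unary entries, and those over
-- the word, which is one letter longer than a row. Hence the strict bound on the width.
record Bounded (N : ℕ) (rows : List (List ℕ)) : Set where
  field
    width   : ∀ i → length (row rows i) < N
    entries : ∀ i → All (_≤ N) (row rows i)

open Bounded

first-≤ : ∀ {N r} → All (_≤ N) r → first r ≤ N
first-≤ []      = z≤n
first-≤ (p ∷ _) = p

lastOr-≤ : ∀ {N d r} → d ≤ N → All (_≤ N) r → lastOr d r ≤ N
lastOr-≤ d≤ []       = d≤
lastOr-≤ d≤ (p ∷ ps) = lastOr-≤ p ps

module _ {N : ℕ} {rows : List (List ℕ)} (bounded : Bounded N rows) where

  consBit-correct : ∀ z end bits → z ≤ N → end ≤ N →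
    ⟦ consBit ⟧ N (encodeℕ z ∙ ((encodeTable rows ∙ encodeℕ end) ∙ bits)) ≡
    encodeBool (first (row rows z) ≡ᵇ end) ∙ bits
  consBit-correct z end bits z≤ end≤ = cong (_∙ bits) (begin
    ⟦ equal ⟧ N (head (⟦ lookupRow ⟧ N (encodeTable rows ∙ encodeℕ z)) ∙ encodeℕ end)
      ≡⟨ cong (λ t → ⟦ equal ⟧ N (t ∙ encodeℕ end))
           (trans (cong head (lookupRow-correct rows z z≤)) (first-correct (row rows z))) ⟩
    ⟦ equal ⟧ N (encodeℕ (first (row rows z)) ∙ encodeℕ end)
      ≡⟨ equal-correct _ end (first-≤ (entries bounded z)) end≤ ⟩
    encodeBool (first (row rows z) ≡ᵇ end) ∎)
    where open ≡-Reasoning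

  reversedBits-correct : ∀ end r → end ≤ N → length r ≤ N → All (_≤ N) r →
    ⟦ reversedBits ⟧ N ((encodeTable rows ∙ encodeℕ end) ∙ encodeRow r) ≡ encodeBits (reverse (bitsOf rows end r))
  reversedBits-correct end r end≤ len r≤ = begin
    _   ≡⟨ fold-correct consBit (map encodeℕ r) (encodeTable rows ∙ encodeℕ end) nil
             (subst (_≤ _) (sym (Listₚ.length-map encodeℕ r)) len) ⟩
    foldl (λ b t → ⟦ consBit ⟧ N (t ∙ ((encodeTable rows ∙ encodeℕ end) ∙ b))) nil (map encodeℕ r)
        ≡⟨ go nil r≤ ⟩
    foldl (λ t z → encodeBool (first (row rows z) ≡ᵇ end) ∙ t) nil r
        ≡⟨ foldl-cons (λ z → encodeBool (first (row rows z) ≡ᵇ end)) [] r ⟩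
    encodeList (reverse (map (λ z → encodeBool (first (row rows z) ≡ᵇ end)) r))
        ≡⟨ cong (encodeList ∘ reverse) (Listₚ.map-∘ r) ⟩
    encodeList (reverse (map encodeBool (bitsOf rows end r)))
        ≡⟨ cong encodeList (Listₚ.reverse-map encodeBool (bitsOf rows end r)) ⟨
    encodeBits (reverse (bitsOf rows end r)) ∎
    where
    open ≡-Reasoning
    go : ∀ {r} a → All (_≤ N) r →
         foldl (λ b t → ⟦ consBit ⟧ N (t ∙ ((encodeTable rows ∙ encodeℕ end) ∙ b))) a (map encodeℕ r) ≡
         foldl (λ t z → encodeBool (first (row rows z) ≡ᵇ end) ∙ t) a r
    go a []                 = refl
    go {z ∷ r} a (z≤ ∷ r≤) = trans
      (cong (λ a → foldl (λ b t → ⟦ consBit ⟧ N (t ∙ ((encodeTable rows ∙ encodeℕ end) ∙ b))) a (map encodeℕ r))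
            (consBit-correct z end a z≤ end≤))
      (go _ r≤)

-- On (table ∙ interior row).
endRow sameEnd allBits wordOf : Fun
endRow  = pair left (right ⟫ left) ⟫ lookupRow
sameEnd = pair (endRow ⟫ lastEntry) (right ⟫ lastEntry) ⟫ equal
allBits = pair (pair left (right ⟫ left)) endRow ⟫ reversedBits
wordOf  = pair sameEnd (branch sameEnd (allBits ⟫ reversal) allBits)

interiorRow : Fun
interiorRow = pair self (left ⟫ right ⟫ left) ⟫ lookupRow

secondEntry : ∀ rows → head (tail (head (encodeTable rows))) ≡ encodeℕ (first (drop 1 (row rows 0)))
secondEntry []                = refl
secondEntry ([] ∷ _)          = refl
secondEntry ((_ ∷ []) ∷ _)    = refl
secondEntry ((_ ∷ _ ∷ _) ∷ _) = refl

module _ {N : ℕ} {rows : List (List ℕ)} (bounded : Bounded N rows) where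

  module _ (r : List ℕ) (r-len : length r ≤ N) (r≤ : All (_≤ N) r) where

    s : Tree
    s = encodeTable rows ∙ encodeRow r

    r₁ : List ℕ
    r₁ = row rows (first r)

    r₁-len : length r₁ ≤ N
    r₁-len = ℕₚ.<⇒≤ (width bounded (first r))

    endRow-correct : ⟦ endRow ⟧ N s ≡ encodeRow r₁
    endRow-correct = trans (cong (λ t → ⟦ lookupRow ⟧ N (encodeTable rows ∙ t)) (first-correct r))
                           (lookupRow-correct rows (first r) (first-≤ r≤))

    sameEnd-correct : ⟦ sameEnd ⟧ N s ≡ encodeBool (lastOr 0 r₁ ≡ᵇ lastOr 0 r)
    sameEnd-correct = trans
      (cong₂ (λ t u → ⟦ equal ⟧ N (t ∙ u))
        (trans (cong (⟦ lastEntry ⟧ N) endRow-correct) (lastEntry-correct r₁ r₁-len))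
        (lastEntry-correct r r-len))
      (equal-correct _ _ (lastOr-≤ z≤n (entries bounded (first r))) (lastOr-≤ z≤n r≤))

    allBits-correct : ⟦ allBits ⟧ N s ≡ encodeBits (reverse (bitsOf rows (first r) r₁))
    allBits-correct = trans
      (cong₂ (λ t u → ⟦ reversedBits ⟧ N ((encodeTable rows ∙ t) ∙ u)) (first-correct r) endRow-correct)
      (reversedBits-correct bounded (first r) r₁ (first-≤ r≤) r₁-len (entries bounded (first r)))

    -- The fold in `reversedBits` turns the letters round, which is the order wanted when the end
    -- person is down; when that person is up, a second reversal undoes it.
    wordOf-correct : ⟦ wordOf ⟧ N s ≡ encodeBits (wordFrom rows r)
    wordOf-correct = trans
      (cong₂ (λ b t → b ∙ choose b (⟦ reversal ⟧ N t) t) sameEnd-correct allBits-correct)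
      (oriented (lastOr 0 r₁ ≡ᵇ lastOr 0 r) (bitsOf rows (first r) r₁)
        (subst (_≤ N) (sym (Listₚ.length-map _ r₁)) r₁-len))
      where
      oriented : ∀ b bs → length bs ≤ N →
        encodeBool b ∙ choose (encodeBool b) (⟦ reversal ⟧ N (encodeBits (reverse bs))) (encodeBits (reverse bs)) ≡
        encodeBits (orient b bs)
      oriented false bs _  = refl
      oriented true  bs le = cong ((nil ∙ nil) ∙_) (trans
        (reversal-correct (reverse bs) (subst (_≤ N) (sym (Listₚ.length-reverse bs)) le))
        (cong encodeBits (Listₚ.reverse-involutive bs)))

  word-correct : ⟦ pair self interiorRow ⟫ wordOf ⟧ N (encodeTable rows) ≡ encodeBits (word rows)
  word-correct = trans
    (cong (λ t → ⟦ wordOf ⟧ N (encodeTable rows ∙ t))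
      (trans (cong (λ t → ⟦ lookupRow ⟧ N (encodeTable rows ∙ t)) (secondEntry rows))
             (lookupRow-correct rows (first (drop 1 (row rows 0))) second-≤)))
    (wordOf-correct (row rows (first (drop 1 (row rows 0)))) (ℕₚ.<⇒≤ (width bounded _)) (entries bounded _))
    where
    second-≤ : first (drop 1 (row rows 0)) ≤ N
    second-≤ with row rows 0 | entries bounded 0
    ... | []        | _          = z≤n
    ... | _ ∷ []    | _          = z≤n
    ... | _ ∷ _ ∷ _ | _ ∷ p ∷ _ = p

  word-length : length (word rows) ≤ N
  word-length = go (lastOr 0 outer ≡ᵇ lastOr 0 inner) (bitsOf rows (first inner) outer)
      (subst (_< N) (sym (Listₚ.length-map _ outer)) (width bounded (first inner)))
    where
    inner = row rows (first (drop 1 (row rows 0)))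
    outer = row rows (first inner)
    go : ∀ b bs → length bs < N → length (orient b bs) ≤ N
    go true  bs le = le
    go false bs le = subst (λ l → suc l ≤ N) (sym (Listₚ.length-reverse bs)) le

increment countTrues : Fun
increment  = branch left (pair empty (right ⟫ right)) (right ⟫ right)
countTrues = pair self (pair empty empty) ⟫ fold increment

countTrues-correct : ∀ {N} bs → length bs ≤ N → ⟦ countTrues ⟧ N (encodeBits bs) ≡ encodeℕ (trues bs)
countTrues-correct bs le = trans
  (fold-correct increment (map encodeBool bs) nil nil (subst (_≤ _) (sym (Listₚ.length-map encodeBool bs)) le))
  (trans (go 0 bs) (cong encodeℕ (ℕₚ.+-identityʳ (trues bs))))
  where
  go : ∀ k bs → foldl (λ a b → choose b (nil ∙ a) a) (encodeℕ k) (map encodeBool bs) ≡ encodeℕ (trues bs + k)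
  go k []           = refl
  go k (false ∷ bs) = go k bs
  go k (true ∷ bs)  = trans (go (suc k) bs) (cong encodeℕ (ℕₚ.+-suc (trues bs) k))

-- On rest ∙ (parity ∙ last).
advance : Fun
advance = pair (left ⟫ right) (pair
  (branch (right ⟫ left) (branch (left ⟫ left) empty truth) (left ⟫ left)) (left ⟫ left))

-- Generalised over the parity `p` and the last letter `d` found so far; `halve` starts with `false`
-- and with the default `true` of `twoBits`.
advance-correct : ∀ {N} k bs p d → k ≤ length bs →
  iterate k (⟦ advance ⟧ N) (encodeBits bs ∙ (encodeBool p ∙ encodeBool d)) ≡
  encodeBits (drop k bs) ∙ (encodeBool (p xor odd (trues (take k bs))) ∙ encodeBool (lastOr d (take k bs)))
advance-correct zero bs p d _ =
  cong (λ q → encodeBits bs ∙ (encodeBool q ∙ encodeBool d)) (sym (xor-identityʳ p))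
advance-correct {N} (suc k) (b ∷ bs) p d (s≤s le) = begin
  iterate k (⟦ advance ⟧ N) (⟦ advance ⟧ N (encodeBits (b ∷ bs) ∙ (encodeBool p ∙ encodeBool d)))
    ≡⟨ cong (λ q → iterate k (⟦ advance ⟧ N) (encodeBits bs ∙ (q ∙ encodeBool b))) (toggle p b) ⟩
  iterate k (⟦ advance ⟧ N) (encodeBits bs ∙ (encodeBool (p xor b) ∙ encodeBool b))
    ≡⟨ advance-correct {N} k bs (p xor b) b le ⟩
  encodeBits (drop k bs) ∙ (encodeBool ((p xor b) xor odd (trues (take k bs))) ∙ encodeBool (lastOr b (take k bs)))
    ≡⟨ cong (λ q → encodeBits (drop k bs) ∙ (encodeBool q ∙ encodeBool (lastOr b (take k bs))))
            (parity b (take k bs)) ⟩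
  encodeBits (drop k bs) ∙ (encodeBool (p xor odd (trues (b ∷ take k bs))) ∙ encodeBool (lastOr b (take k bs))) ∎
  where
  open ≡-Reasoning
  toggle : ∀ p b → choose (encodeBool p) (choose (encodeBool b) nil (nil ∙ nil)) (encodeBool b) ≡ encodeBool (p xor b)
  toggle false b     = refl
  toggle true  false = refl
  toggle true  true  = refl
  parity : ∀ b bs → (p xor b) xor odd (trues bs) ≡ p xor odd (trues (b ∷ bs))
  parity false bs = cong (_xor odd (trues bs)) (xor-identityʳ p)
  parity true  bs = xor-assoc p true (odd (trues bs))

halve : Fun
halve = pair countTrues (pair empty (pair self (pair empty truth))) ⟫ times advance

verdict : Fun
verdict = branch (right ⟫ left)
  (branch (right ⟫ right) (left ⟫ left) (branch (left ⟫ left) empty truth))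
  empty

decide : Fun
decide = pair self interiorRow ⟫ wordOf ⟫ halve ⟫ verdict

trues-≤ : ∀ bs → trues bs ≤ length bs
trues-≤ []           = z≤n
trues-≤ (true ∷ bs)  = s≤s (trues-≤ bs)
trues-≤ (false ∷ bs) = ℕₚ.m≤n⇒m≤1+n (trues-≤ bs)

halve-correct : ∀ {N} bs → length bs ≤ N → let k = trues bs in
  ⟦ halve ⟧ N (encodeBits bs) ≡
  encodeBits (drop k bs) ∙ (encodeBool (odd (trues (take k bs))) ∙ encodeBool (lastOr true (take k bs)))
halve-correct {N} bs le = trans
  (cong (λ t → ⟦ times advance ⟧ N (t ∙ (nil ∙ start))) (countTrues-correct bs le))
  (trans (times-correct advance (trues bs) nil start (ℕₚ.≤-trans (trues-≤ bs) le))
         (advance-correct {N} (trues bs) bs false true (trues-≤ bs)))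
  where
  start : Tree
  start = encodeBits bs ∙ (encodeBool false ∙ encodeBool true)

-- The head of the empty list is `nil`, which encodes the default `false` of `headOr`.
verdict-correct : ∀ {N} bs p d →
  ⟦ verdict ⟧ N (encodeBits bs ∙ (encodeBool p ∙ encodeBool d)) ≡ encodeBool (p ∧ same d (headOr false bs))
verdict-correct bs           false d     = refl
verdict-correct []           true  false = refl
verdict-correct []           true  true  = refl
verdict-correct (false ∷ bs) true  false = refl
verdict-correct (true ∷ bs)  true  false = refl
verdict-correct (b ∷ bs)     true  true  = refl

twoBits-correct : ∀ {N} bs → length bs ≤ N → ⟦ halve ⟫ verdict ⟧ N (encodeBits bs) ≡ encodeBool (twoBits bs)
twoBits-correct {N} bs le = trans (cong (⟦ verdict ⟧ N) (halve-correct bs le))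
  (verdict-correct {N} (drop k bs) (odd (trues (take k bs))) (lastOr true (take k bs)))
  where k = trues bs

oneOrTwo : Fun
oneOrTwo = branch decide (pair empty truth) truth

oneOrTwo-correct : ∀ {N rows} → Bounded N rows →
  ⟦ oneOrTwo ⟧ N (encodeTable rows) ≡ encodeℕ (ifᵇ answer rows then 2 else 1)
oneOrTwo-correct {N} {rows} bounded = trans
  (cong (λ t → choose t (nil ∙ (nil ∙ nil)) (nil ∙ nil))
    (trans (cong (⟦ halve ⟫ verdict ⟧ N) (word-correct bounded)) (twoBits-correct (word rows) (word-length bounded))))
  (final (answer rows))
  where
  final : ∀ b → choose (encodeBool b) (nil ∙ (nil ∙ nil)) (nil ∙ nil) ≡ encodeℕ (ifᵇ b then 2 else 1)
  final true  = refl
  final false = refl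

row-all : ∀ (P : List ℕ → Set) {rows} → P [] → All P rows → ∀ i → P (row rows i)
row-all P p []       i       = p
row-all P p (q ∷ qs) zero    = q
row-all P p (q ∷ qs) (suc i) = row-all P p qs i

all-rows : ∀ {P : List ℕ → Set} {n} (I : Roommates n) → (∀ x → P (map toℕ (prefs I x))) → All P (table I)
all-rows I p = Allₚ.map⁺ (All.tabulate (λ {x} _ → p x))

bounded-table : ∀ {n} (I : Roommates n) → 1 ≤ n → Bounded (2 * n) (table I)
bounded-table {n} I n≥1 = record
  -- The strict bound must also hold for the default row `[]`, which takes `n≥1`.
  { width   = row-all (λ r → length r < 2 * n) (ℕₚ.≤-trans n≥1 (ℕₚ.m≤m+n n (n + 0))) (all-rows I λ x →
      ℕₚ.≤-reflexive (trans (cong suc (Listₚ.length-map toℕ (prefs I x))) (length-prefs I x)))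
  ; entries = row-all (All (_≤ 2 * n)) [] (all-rows I λ x →
      Allₚ.map⁺ (All.tabulate (λ {y} _ → ℕₚ.<⇒≤ (toℕ<n y)))) }

encode-table : ∀ {n} (I : Roommates n) → encodeRoommates I ≡ encodeTable (table I)
encode-table {n} I = cong encodeList
  (trans (Listₚ.map-cong (λ x → cong encodeList (Listₚ.map-∘ (prefs I x))) (allFin (2 * n)))
         (Listₚ.map-∘ (allFin (2 * n))))

spine-list : ∀ ts → spine (encodeList ts) ≡ length ts
spine-list []       = refl
spine-list (_ ∷ ts) = cong suc (spine-list ts)

spine-encode : ∀ {n} (I : Roommates n) → spine (encodeRoommates I) ≡ 2 * n
spine-encode {n} I = trans (spine-list _)
  (trans (Listₚ.length-map _ (allFin (2 * n))) (Listₚ.length-tabulate {n = 2 * n} (λ y → y)))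

number-answer : ∀ I → let open OneAttributeSR I in
                numberOfStableAssignments I ≡ (ifᵇ answer (table roommates) then 2 else 1)
number-answer I = count-answer roommates n≥1 model
  where open OneAttributeSR I

theorem4 : (∀ (I : OneAttributeSR) → numberOfStableAssignments I ≡ 1 ⊎ numberOfStableAssignments I ≡ 2)
    × PolynomialTime encodeInstance numberOfStableAssignments
theorem4 = one-or-two , polynomialTime encodeInstance oneOrTwo computes
  where
  one-or-two : ∀ I → numberOfStableAssignments I ≡ 1 ⊎ numberOfStableAssignments I ≡ 2
  one-or-two I with answer (table (OneAttributeSR.roommates I)) | number-answer I
  ... | false | eq = inj₁ eq
  ... | true  | eq = inj₂ eq
  computes : ∀ I → ⟦ oneOrTwo ⟧ (spine (encodeInstance I)) (encodeInstance I) ≡ encodeℕ (numberOfStableAssignments I)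
  computes I = begin
    ⟦ oneOrTwo ⟧ (spine (encodeRoommates roommates)) (encodeRoommates roommates)
      ≡⟨ cong₂ ⟦ oneOrTwo ⟧ (spine-encode roommates) (encode-table roommates) ⟩
    ⟦ oneOrTwo ⟧ (2 * n) (encodeTable (table roommates))
      ≡⟨ oneOrTwo-correct (bounded-table roommates n≥1) ⟩
    encodeℕ (ifᵇ answer (table roommates) then 2 else 1)
      ≡⟨ cong encodeℕ (number-answer I) ⟨
    encodeℕ (numberOfStableAssignments I) ∎
    where
    open OneAttributeSR I
    open ≡-Reasoning
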